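{- Consider the single-row edge-matching problem with the free border rule in which both swaps and rotations are allowed: given $M$ pieces whose edges are colored with $K$ colors, decide whether the $M$ pieces can be placed in the cells of a $1\times M$ board in some order, each rotated by some multiple of $90^\circ$, such that every two horizontally adjacent pieces have the same color on their touching edges. For two colors ($K=2$) this problem is solvable in time $O(M)$. For $K$ colors it is solvable in time $O(M+5^{K^4})$.
   Context: A piece is a unit square whose four edges are colored; it is given by a tuple $(c_r,c_t,c_l,c_b)$ of the colors on its right, top, left and bottom edges, in this (counter-clockwise) order. Swaps: any two pieces may interchange their positions without being rotated. Rotations: each piece may be rotated in place counter-clockwise by $0^\circ$, $90^\circ$, $180^\circ$ or $270^\circ$, i.e. its color tuple is cyclically shifted. Free border rule: edges facing the border of the board (in a single row: all top and bottom edges, the left edge of the leftmost piece and the right edge of the rightmost piece) are unrestricted. Running times are on a unit-cost random access machine, with colors given as integers in $\{1,\dots,K\}$. -}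

module Defs where

open import Data.Bool.Base using (Bool; true; false; if_then_else_)
open import Data.Fin.Base using (Fin; toℕ)
open import Data.Fin.Permutation using (Permutation′; _⟨$⟩ʳ_)
open import Data.List.Base using (List; []; _∷_; head; drop; concatMap; allFin)
open import Data.Maybe.Base using (Maybe; just; nothing)
open import Data.Nat.Base using (ℕ; zero; suc; _+_; _*_; _∸_; _≡ᵇ_; _≤_; _<_)
open import Data.Nat.GeneralisedArithmetic using (fold)
open import Data.Product.Base using (Σ; ∃; ∃-syntax; _×_; _,_)
open import Relation.Binary.PropositionalEquality.Core using (_≡_)
open import Relation.Nullary.Reflects using (Reflects)

------------------------------------------------------------------------
-- Edge matching in a single row

record Piece (K : ℕ) : Set where
  constructor piece
  field
    right top left bottom : Fin K

open Piece public

-- Counter-clockwise by 90°: the bottom edge becomes the right edge, the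
-- right edge becomes the top edge, and so on.
rotate : ∀ {K} → Piece K → Piece K
rotate (piece r t l b) = piece b r t l

rotateBy : ∀ {K} → Fin 4 → Piece K → Piece K
rotateBy k p = fold p rotate (toℕ k)

record Puzzle (K : ℕ) : Set where
  constructor puzzle
  field
    size   : ℕ
    pieces : Fin size → Piece K

open Puzzle public

-- `order` sends each cell, numbered from the left, to the piece placed in
-- it; `rotation` is indexed by pieces.
record Placement (M : ℕ) : Set where
  field
    order    : Permutation′ M
    rotation : Fin M → Fin 4

placedAt : ∀ {K} (P : Puzzle K) → Placement (size P) → Fin (size P) → Piece K
placedAt P pl cell = rotateBy (rotation i) (pieces P i)
  where
  open Placement pl
  i = order ⟨$⟩ʳ cell

-- Free border: only edges shared by two cells are constrained.
Matching : ∀ {K} (P : Puzzle K) → Placement (size P) → Set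
Matching P pl = ∀ i j → toℕ j ≡ suc (toℕ i) →
  right (placedAt P pl i) ≡ left (placedAt P pl j)

Solvable : ∀ {K} → Puzzle K → Set
Solvable P = ∃[ pl ] Matching P pl

------------------------------------------------------------------------
-- Unit-cost random access machine, after Cook and Reckhow (1973), with
-- registers X₀, X₁, … over ℕ and truncated subtraction.  There is no
-- multiplication instruction.

Reg : Set
Reg = ℕ

data Op : Set where
  const   : Reg → ℕ → Op            -- Xᵢ ← c
  add sub : Reg → Reg → Reg → Op    -- Xᵢ ← Xⱼ ± Xₖ
  load    : Reg → Reg → Op          -- Xᵢ ← X at address Xⱼ
  store   : Reg → Reg → Op          -- X at address Xᵢ ← Xⱼ
  read    : Reg → Op                -- Xᵢ ← next input number (0 if exhausted)
  jump    : ℕ → Reg → Op            -- go to instruction m if Xⱼ > 0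

data Instr : Set where
  op   : Op → Instr
  halt : Bool → Instr               -- stop, answering yes (true) or no (false)

Program : Set
Program = List Instr

record State : Set where
  constructor state
  field
    pc    : ℕ
    regs  : Reg → ℕ
    input : List ℕ

_[_≔_] : (Reg → ℕ) → Reg → ℕ → (Reg → ℕ)
(X [ i ≔ v ]) j = if j ≡ᵇ i then v else X j

exec : Op → State → State
exec (const i c) (state pc X xs)       = state (suc pc) (X [ i ≔ c ]) xs
exec (add i j k) (state pc X xs)       = state (suc pc) (X [ i ≔ X j + X k ]) xs
exec (sub i j k) (state pc X xs)       = state (suc pc) (X [ i ≔ X j ∸ X k ]) xs
exec (load i j)  (state pc X xs)       = state (suc pc) (X [ i ≔ X (X j) ]) xs
exec (store i j) (state pc X xs)       = state (suc pc) (X [ X i ≔ X j ]) xs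
exec (read i)    (state pc X [])       = state (suc pc) (X [ i ≔ 0 ]) []
exec (read i)    (state pc X (x ∷ xs)) = state (suc pc) (X [ i ≔ x ]) xs
exec (jump m j)  (state pc X xs)       =
  state (if X j ≡ᵇ 0 then suc pc else m) X xs

fetch : Program → ℕ → Maybe Instr
fetch p n = head (drop n p)

-- `run p t s ≡ just b` : started in s, the program p halts with answer b
-- after executing at most t instructions, the final `halt` included.
-- A program counter outside the program never yields an answer.
run : Program → ℕ → State → Maybe Bool
resume : Program → ℕ → State → Maybe Instr → Maybe Bool

run p zero    s = nothing
run p (suc t) s = resume p t s (fetch p (State.pc s))

resume p t s nothing         = nothing
resume p t s (just (halt b)) = just b
resume p t s (just (op o))   = run p t (exec o s)

initial : List ℕ → State
initial xs = state 0 (λ _ → 0) xs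

------------------------------------------------------------------------
-- Decision problems and running times

record Problem : Set₁ where
  field
    Instance : Set
    encode   : Instance → List ℕ
    Yes      : Instance → Set

open Problem public

-- One program and one constant serve all instances.  The program must
-- answer correctly on every instance; the bound t ≤ c * f x is required
-- wherever f x is positive (it is unattainable if f x is zero).
SolvableInTimeO : (Q : Problem) → (Instance Q → ℕ) → Set
SolvableInTimeO Q f =
  Σ Program λ p → Σ ℕ λ c → ∀ (x : Instance Q) →
    ∃[ t ] ∃[ b ] run p t (initial (encode Q x)) ≡ just b
                × Reflects (Yes Q x) b
                × (0 < f x → t ≤ c * f x)

-- Colors are written as 1, …, K.
encodePiece : ∀ {K} → Piece K → List ℕ
encodePiece (piece r t l b) =
  suc (toℕ r) ∷ suc (toℕ t) ∷ suc (toℕ l) ∷ suc (toℕ b) ∷ []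

encodePuzzle : ∀ K → Puzzle K → List ℕ
encodePuzzle K P =
  size P ∷ K ∷ concatMap (λ i → encodePiece (pieces P i)) (allFin (size P))

-- The number of colors is fixed in `rowMatching K` and part of the
-- instance in `rowMatchingAnyK`.
rowMatching : ℕ → Problem
rowMatching K = record
  { Instance = Puzzle K
  ; encode   = encodePuzzle K
  ; Yes      = Solvable
  }

rowMatchingAnyK : Problem
rowMatchingAnyK = record
  { Instance = ∃ Puzzle
  ; encode   = λ (K , P) → encodePuzzle K P
  ; Yes      = λ (K , P) → Solvable P
  }

{-# OPTIONS --safe #-}

-- Up to rotation a piece is a pair of unordered colour pairs, its kind, and
-- placing it means walking along one of its two pairs, in either direction.
-- If a kind occurs five times in a row of pieces, two of its pieces are
-- turned the same way; reversing the stretch between them lets both be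
-- dropped.  Conversely a piece may be replaced by three, walking back and
-- forth.  So the multiplicities can be cut down to at most 4, which one
-- linear pass over the input does.
--
-- With K colours there are about K⁴/8 kinds, so m ≲ K⁴/2 pieces remain, and
-- dynamic programming over their 2ᵐ subsets, recording the possible leftmost
-- colours of a row, takes time O(m 2ᵐ) ≤ O(4ᵐ), below O(5^(K⁴)).  For K = 2
-- the second summand is a constant.
--
-- The random access machine is programmed in a small language of arrays and
-- bounded loops, whose programs are total functions with a computable cost.

module Submission where

open import Data.Bool.Base using (Bool; true; false; if_then_else_; _∧_; _∨_)
open import Data.Empty using (⊥-elim)
open import Data.Fin using (#_)
import Data.Fin.Base as Fin
open import Data.Fin.Base using (Fin; zero; suc; toℕ; cast)
open import Data.Fin.Permutation
  using (Permutation; Permutation′; _⟨$⟩ʳ_; _⟨$⟩ˡ_; inverseˡ; inverseʳ; cast-id; _∘ₚ_)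
  renaming (flip to inverse)
open import Data.Fin.Properties using (toℕ<n; toℕ-injective; pigeonhole; toℕ-cast)
open import Data.List.Base
  using (List; []; _∷_; _++_; length; drop; map; lookup; tabulate; allFin; replicate; concatMap)
open import Data.List.Membership.Propositional using (_∈_)
open import Data.List.Membership.Propositional.Properties using (∈-∃++; ∈-++⁻; ∈-map⁻; ∈-tabulate⁺)
open import Data.List.Membership.Propositional.Properties.WithK using (unique∧set⇒bag)
open import Data.List.Properties
  using (length-++; map-++; ++-assoc; ∷-injective; map-tabulate; length-tabulate; length-map;
         lookup-tabulate; length-replicate; ++-identityʳ)
open import Data.List.Relation.Binary.BagAndSetEquality using (∼bag⇒↭)
open import Data.List.Relation.Binary.Permutation.Homogeneous using (onIndices)
open import Data.List.Relation.Binary.Permutation.Propositional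
  using (_↭_; ↭-refl; ↭-sym; ↭-trans; ↭-prep; ↭-swap; ↭-reflexive; ↭⇒↭ₛ)
open import Data.List.Relation.Binary.Permutation.Propositional.Properties
  using (↭-map-inv; ∈-resp-↭; All-resp-↭; drop-mid; drop-∷; shift; ++-comm; ++⁺ˡ; ++⁺ʳ;
         ↭-length; ↭-empty-inv)
  renaming (map⁺ to ↭-map⁺)
open import Data.List.Relation.Binary.Permutation.Setoid.Properties using (onIndices-lookup)
import Data.List.Relation.Unary.All as All
open import Data.List.Relation.Unary.All using (All; []; _∷_)
open import Data.List.Relation.Unary.All.Properties using (replicate⁺)
open import Data.List.Relation.Unary.Any using (here; there)
open import Data.List.Relation.Unary.Unique.Propositional.Properties using (allFin⁺; tabulate⁺)
open import Data.Maybe.Base using (just)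
open import Data.Nat.Base
open import Data.Nat.DivMod
  using (_%_; [m+kn]%n≡m%n; m<n⇒m%n≡m; _/_; +-distrib-/-∣ʳ; m<n⇒m/n≡0; m*n/n≡m)
open import Data.Nat.Divisibility using (n∣m*n)
open import Data.Nat.Properties
open import Data.Nat.Tactic.RingSolver using (solve-∀)
open import Data.Product.Base using (∃; ∃-syntax; _×_; _,_; proj₁; proj₂)
open import Data.Sum.Base using (_⊎_; inj₁; inj₂)
open import Data.Unit.Base using (⊤; tt)
open import Function.Bundles using (mk⇔)
open import Relation.Binary.Definitions using (tri<; tri≈; tri>)
open import Relation.Binary.PropositionalEquality
  using (_≡_; _≢_; refl; sym; trans; cong; cong₂; subst; subst₂; module ≡-Reasoning; setoid)
open import Relation.Nullary using (yes; no; Dec)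
open import Relation.Nullary.Reflects using (Reflects; ofʸ; ofⁿ)
open import Defs

-- A structured language with arrays and bounded loops

-- Five is one more than the number of quarter turns, so the pigeonhole principle applies. Dropping
-- leads from five copies to three, so a copy remains from which the dropped pair can be restored;
-- the reduction is therefore an equivalence, and it can be applied piece by piece to a table whose
-- entries never exceed 4.
--
-- The machine shapes the algorithm: it has no multiplication, and its only test is for zero. Kinds
-- are numbered through a table of triangular numbers, offsets into the dynamic programming table
-- are kept multiplied by K + 1, a conditional is a loop run 0 or 1 times, and disjunction is
-- addition of counts of which only positivity matters. Registers start at 0, so no array is
-- cleared.
--
-- Removing an item from a subset clears a binary digit and gives a smaller number; filling the
-- table in increasing order therefore meets every dependency.
--
-- With L four times the number of kinds, 4 ^ L is 2 to a power with leading term K⁴. Replacing that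
-- term by 2K⁴ absorbs all lower-order terms up to a constant.

Name : Set
Name = Fin 30

Store : Set
Store = Name → ℕ → ℕ

Mem : Set
Mem = Store × List ℕ

infixl 6 _⊕_ _⊖_
infix  7 _!_
infix  5 _⟨_⟩≔_ _≔_
infixr 4 _▸_

data Exp : Set where
  con     : ℕ → Exp
  _⊕_ _⊖_ : Exp → Exp → Exp
  _!_     : Name → Exp → Exp

-- Scalars are arrays of which only cell 0 is used.
var : Name → Exp
var a = a ! con 0

data Cmd : Set where
  _⟨_⟩≔_ : Name → Exp → Exp → Cmd
  get    : Name → Cmd
  _▸_    : Cmd → Cmd → Cmd
  for    : Exp → Cmd → Cmd

_≔_ : Name → Exp → Cmd
a ≔ e = a ⟨ con 0 ⟩≔ e

eval : Exp → Store → ℕ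
eval (con n)  σ = n
eval (e ⊕ e′) σ = eval e σ + eval e′ σ
eval (e ⊖ e′) σ = eval e σ ∸ eval e′ σ
eval (a ! e)  σ = σ a (eval e σ)

set : Store → Name → ℕ → ℕ → Store
set σ a i v b j = if (toℕ b ≡ᵇ toℕ a) ∧ (j ≡ᵇ i) then v else σ b j

first : List ℕ → ℕ
first []      = 0
first (x ∷ _) = x

iter : ∀ {A : Set} → ℕ → (A → A) → A → A
iter zero    f x = x
iter (suc n) f x = iter n f (f x)

-- The number of iterations of a loop is fixed on entry, which makes every command a total function.
⟦_⟧ : Cmd → Mem → Mem
⟦ a ⟨ e ⟩≔ e′ ⟧ (σ , xs) = set σ a (eval e σ) (eval e′ σ) , xs
⟦ get a ⟧       (σ , xs) = set σ a 0 (first xs) , drop 1 xs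
⟦ c ▸ c′ ⟧      μ        = ⟦ c′ ⟧ (⟦ c ⟧ μ)
⟦ for e c ⟧     μ        = iter (eval e (proj₁ μ)) ⟦ c ⟧ μ

-- Exact instruction counts of the compiled code; the 7 is the length of `locate`.
expCost : Exp → ℕ
expCost (con n)  = 1
expCost (e ⊕ e′) = expCost e + (expCost e′ + 1)
expCost (e ⊖ e′) = expCost e + (expCost e′ + 1)
expCost (a ! e)  = expCost e + (7 + 1)

loopCost : (Mem → ℕ) → (Mem → Mem) → ℕ → Mem → ℕ
loopCost k f zero    μ = 0
loopCost k f (suc n) μ = k μ + 3 + loopCost k f n (f μ)

-- In a loop, 4 pays for `loopHead`, the 3 in `loopCost` for the jump into the body and the two
-- instructions that decrement the counter, and the last 1 for the jump that fails.
cost : Cmd → Mem → ℕ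
cost (a ⟨ e ⟩≔ e′) μ = expCost e + (7 + (expCost e′ + 1))
cost (get a)       μ = 1
cost (c ▸ c′)      μ = cost c μ + cost c′ (⟦ c ⟧ μ)
cost (for e c)     μ = expCost e + 4 + (loopCost (cost c) ⟦ c ⟧ (eval e (proj₁ μ)) μ + 1)

-- Compilation

double : ℕ → ℕ
double n = n + n

double⁵ : ∀ i → double (double (double (double (double i)))) ≡ i * 32
double⁵ i = trans (twice _ (twice _ (twice _ (twice _ (twice i refl))))) (collect i)
  where
  twice : ∀ {m} n → m ≡ n → double m ≡ n * 2
  twice {m} n refl = trans (cong (m +_) (sym (+-identityʳ m))) (*-comm 2 m)
  collect : ∀ i → i * 2 * 2 * 2 * 2 * 2 ≡ i * 32
  collect = solve-∀

-- The registers are split into 32 interleaved arrays: array 0 is the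
-- evaluation stack, array 1 the loop counters, the others hold the store.
abstract
  reg : Fin 32 → ℕ → Reg
  reg a i = i * 32 + toℕ a

  reg-shape : ∀ a i → reg a i ≡ double (double (double (double (double i)))) + toℕ a
  reg-shape a i = cong (_+ toℕ a) (sym (double⁵ i))

  reg-injective : ∀ a b {i j} → reg a i ≡ reg b j → a ≡ b × i ≡ j
  reg-injective a b {i} {j} eq = a≡b , i≡j
    where
    eq′ : toℕ a + i * 32 ≡ toℕ b + j * 32
    eq′ = trans (+-comm (toℕ a) _) (trans eq (+-comm (j * 32) _))
    digit : ∀ (a : Fin 32) i → (toℕ a + i * 32) % 32 ≡ toℕ a
    digit a i = trans ([m+kn]%n≡m%n (toℕ a) i 32) (m<n⇒m%n≡m (toℕ<n a))
    a≡b : a ≡ b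
    a≡b = toℕ-injective (trans (sym (digit a i)) (trans (cong (_% 32) eq′) (digit b j)))
    i≡j : i ≡ j
    i≡j = *-cancelʳ-≡ i j 32 (+-cancelˡ-≡ (toℕ a) _ _
            (trans eq′ (cong (λ c → toℕ c + j * 32) (sym a≡b))))

tmp ctr : ℕ → Reg
tmp = reg zero
ctr = reg (suc zero)

cell : Name → ℕ → Reg
cell a = reg (suc (suc a))

-- Five doublings replace the missing multiplication by 32; this is why the number of interleaved
-- arrays is a power of two.
locate : Name → ℕ → List Instr
locate a d =
  dbl ∷ dbl ∷ dbl ∷ dbl ∷ dbl ∷ op (const (tmp (suc d)) (2 + toℕ a))
  ∷ op (add (tmp d) (tmp d) (tmp (suc d))) ∷ []
  where
  dbl : Instr
  dbl = op (add (tmp d) (tmp d) (tmp d))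

compileExp : Exp → ℕ → List Instr
compileExp (con n)  d = op (const (tmp d) n) ∷ []
compileExp (e ⊕ e′) d =
  compileExp e d ++ (compileExp e′ (suc d) ++ op (add (tmp d) (tmp d) (tmp (suc d))) ∷ [])
compileExp (e ⊖ e′) d =
  compileExp e d ++ (compileExp e′ (suc d) ++ op (sub (tmp d) (tmp d) (tmp (suc d))) ∷ [])
compileExp (a ! e)  d = compileExp e d ++ (locate a d ++ op (load (tmp d) (tmp d)) ∷ [])

-- The machine neither copies registers nor jumps unconditionally: a copy adds zero, a jump tests a
-- constant 1. Entering at the test in the foot makes a count of 0 skip the body.
loopHead : ℕ → ℕ → List Instr
loopHead test d =
  op (const (tmp 1) 0) ∷ op (add (ctr d) (tmp 0) (tmp 1))
  ∷ op (const (tmp 0) 1) ∷ op (jump test (tmp 0)) ∷ []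

loopFoot : ℕ → ℕ → List Instr
loopFoot body d =
  op (const (tmp 0) 1) ∷ op (sub (ctr d) (ctr d) (tmp 0)) ∷ op (jump body (ctr d)) ∷ []

-- `compile c n d` is meant to be placed at address n, under d loops.
compile : Cmd → ℕ → ℕ → List Instr
compile (a ⟨ e ⟩≔ e′) n d =
  compileExp e 0 ++ (locate a 0 ++ (compileExp e′ 1 ++ op (store (tmp 0) (tmp 1)) ∷ []))
compile (get a)       n d = op (read (cell a 0)) ∷ []
compile (c ▸ c′)      n d =
  compile c n d ++ compile c′ (n + length (compile c n d)) d
compile (for e c)     n d =
  -- The jump is the third instruction of `loopFoot`, hence the offset 2 after the code of the body.
  compileExp e 0 ++ (loopHead (body + length code + 2) d ++ (code ++ loopFoot body d))
  where
  body : ℕ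
  body = n + length (compileExp e 0) + 4
  code : List Instr
  code = compile c body (suc d)

-- Correctness of the compiler

≡ᵇ-refl : ∀ n → (n ≡ᵇ n) ≡ true
≡ᵇ-refl zero    = refl
≡ᵇ-refl (suc n) = ≡ᵇ-refl n

≢⇒≡ᵇ : ∀ {m n} → m ≢ n → (m ≡ᵇ n) ≡ false
≢⇒≡ᵇ {zero}  {zero}  m≢n = ⊥-elim (m≢n refl)
≢⇒≡ᵇ {zero}  {suc n} m≢n = refl
≢⇒≡ᵇ {suc m} {zero}  m≢n = refl
≢⇒≡ᵇ {suc m} {suc n} m≢n = ≢⇒≡ᵇ (λ eq → m≢n (cong suc eq))

update-same : ∀ (X : Reg → ℕ) i v → (X [ i ≔ v ]) i ≡ v
update-same X i v rewrite ≡ᵇ-refl i = refl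

update-other : ∀ (X : Reg → ℕ) {i j} v → j ≢ i → (X [ i ≔ v ]) j ≡ X j
update-other X v j≢i rewrite ≢⇒≡ᵇ j≢i = refl

CodeAt : Program → ℕ → List Instr → Set
CodeAt p n []       = ⊤
CodeAt p n (i ∷ is) = fetch p n ≡ just i × CodeAt p (suc n) is

codeAt-++⁻ : ∀ {p} n xs {ys} → CodeAt p n (xs ++ ys) →
             CodeAt p n xs × CodeAt p (n + length xs) ys
codeAt-++⁻ {p} n []       at       = tt , subst (λ n → CodeAt p n _) (sym (+-identityʳ n)) at
codeAt-++⁻ {p} n (x ∷ xs) {ys} (f , at) with codeAt-++⁻ (suc n) xs at
... | at₁ , at₂ = (f , at₁) , subst (λ n → CodeAt p n ys) (sym (+-suc n (length xs))) at₂

codeAt-self : ∀ p → CodeAt p 0 p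
codeAt-self p = go [] p
  where
  fetch-++ : ∀ xs {y ys} → fetch (xs ++ y ∷ ys) (length xs) ≡ just y
  fetch-++ []       = refl
  fetch-++ (x ∷ xs) = fetch-++ xs
  snoc : ∀ xs {y : Instr} {ys} → (xs ++ y ∷ []) ++ ys ≡ xs ++ y ∷ ys
  snoc []       = refl
  snoc (x ∷ xs) = cong (x ∷_) (snoc xs)
  length-snoc : ∀ xs {y : Instr} → length (xs ++ y ∷ []) ≡ suc (length xs)
  length-snoc []       = refl
  length-snoc (x ∷ xs) = cong suc (length-snoc xs)
  go : ∀ xs ys → CodeAt (xs ++ ys) (length xs) ys
  go xs []       = tt
  go xs (y ∷ ys) = fetch-++ xs , subst₂ (λ p n → CodeAt p n ys) (snoc xs) (length-snoc xs)
                                   (go (xs ++ y ∷ []) ys)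

-- Quantifying over the fuel k that is left turns sequencing into transitivity of equality.
record Reaches (p : Program) (s : State) (t : ℕ) (s′ : State) : Set where
  constructor reaches
  field
    follow : ∀ k → run p (t + k) s ≡ run p k s′

open Reaches

reaches-trans : ∀ {p s s′ s″ t u} → Reaches p s t s′ → Reaches p s′ u s″ → Reaches p s (t + u) s″
reaches-trans {p} {s} {t = t} {u} r r′ .follow k =
  trans (cong (λ t → run p t s) (+-assoc t u k)) (trans (r .follow (u + k)) (r′ .follow k))

reaches-step : ∀ {p} s {o} → fetch p (State.pc s) ≡ just (op o) → Reaches p s 1 (exec o s)
reaches-step s f .follow k rewrite f = refl

Block : ℕ → List Instr → (Reg → ℕ) → List ℕ → ℕ → (Reg → ℕ) → List ℕ → Set
Block n code X xs t X′ xs′ = ∀ {p} → CodeAt p n code →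
  Reaches p (state n X xs) t (state (n + length code) X′ xs′)

block-++ : ∀ {n c c′ X X′ X″ xs xs′ xs″ t t′} → Block n c X xs t X′ xs′ →
           Block (n + length c) c′ X′ xs′ t′ X″ xs″ →
           Block n (c ++ c′) X xs (t + t′) X″ xs″
block-++ {n} {c} {c′} {X} {X″ = X″} {xs} {xs″ = xs″} {t} {t′} b b′ {p} at
  with codeAt-++⁻ n c at
... | at₁ , at₂ = subst (λ k → Reaches p (state n X xs) (t + t′) (state k X″ xs″))
                    (trans (+-assoc n (length c) (length c′)) (cong (n +_) (sym (length-++ c))))
                    (reaches-trans (b at₁) (b′ at₂))

block-op : ∀ {n} o {X X′ xs xs′} → exec o (state n X xs) ≡ state (suc n) X′ xs′ →
           Block n (op o ∷ []) X xs 1 X′ xs′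
block-op {n} o {X} {X′} {xs} {xs′} eq {p} (f , _) =
  subst (Reaches p (state n X xs) 1) (trans eq (cong (λ k → state k X′ xs′) (sym (+-comm n 1))))
        (reaches-step (state n X xs) f)

-- The stack discipline: code at depth d may clobber only stack cells from d upwards, so a left
-- operand at depth d survives the evaluation of the right one at depth `suc d`.
Agree : ℕ → (Reg → ℕ) → (Reg → ℕ) → Set
Agree d X X′ = ∀ r → (∀ j → d ≤ j → r ≢ tmp j) → X′ r ≡ X r

agree-trans : ∀ {d X X′ X″} → Agree d X X′ → Agree d X′ X″ → Agree d X X″
agree-trans f g r h = trans (g r h) (f r h)

agree-weaken : ∀ {d X X′} → Agree (suc d) X X′ → Agree d X X′
agree-weaken f r h = f r (λ j d<j → h j (<⇒≤ d<j))

agree-update : ∀ d X v → Agree d X (X [ tmp d ≔ v ])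
agree-update d X v r h = update-other X v (h d ≤-refl)

tmp≢ : ∀ {d j} → d < j → tmp d ≢ tmp j
tmp≢ d<j eq = <⇒≢ d<j (proj₂ (reg-injective zero zero eq))

agree-tmp : ∀ {d X X′} → Agree (suc d) X X′ → X′ (tmp d) ≡ X (tmp d)
agree-tmp f = f _ (λ j d<j → tmp≢ d<j)

Represents : (Reg → ℕ) → Store → Set
Represents X σ = ∀ a i → X (cell a i) ≡ σ a i

cell≢tmp : ∀ a i j → cell a i ≢ tmp j
cell≢tmp a i j eq with proj₁ (reg-injective (suc (suc a)) zero {i} {j} eq)
... | ()

ctr≢tmp : ∀ i j → ctr i ≢ tmp j
ctr≢tmp i j eq with proj₁ (reg-injective (suc zero) zero {i} {j} eq)
... | ()

cell≢ctr : ∀ a i j → cell a i ≢ ctr j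
cell≢ctr a i j eq with proj₁ (reg-injective (suc (suc a)) (suc zero) {i} {j} eq)
... | ()

represents-agree : ∀ {d X X′ σ} → Agree d X X′ → Represents X σ → Represents X′ σ
represents-agree f rep a i = trans (f _ (λ j _ → cell≢tmp a i j)) (rep a i)

Computes : ℕ → List Instr → ℕ → ℕ → (Reg → ℕ) → ℕ → Set
Computes n code t d X v = ∃[ X′ ] (∀ xs → Block n code X xs t X′ xs) × X′ (tmp d) ≡ v × Agree d X X′

locate-correct : ∀ n a d X i → X (tmp d) ≡ i → Computes n (locate a d) 7 d X (cell a i)
locate-correct n a d X i eq = subst (Computes n (locate a d) 7 d X) (sym (reg-shape (suc (suc a)) i)) (
  go X eq λ {n} X₁ e₁ → go X₁ e₁ λ X₂ e₂ → go X₂ e₂ λ X₃ e₃ → go X₃ e₃ λ X₄ e₄ → go X₄ e₄ λ X₅ e₅ →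
    last X₅ e₅)
  where
  go : ∀ {n v k c t} X → X (tmp d) ≡ v →
       (∀ {n} X′ → X′ (tmp d) ≡ double v → Computes n c t d X′ k) →
       Computes n (op (add (tmp d) (tmp d) (tmp d)) ∷ c) (suc t) d X k
  go {n} {v} X eq next
    with next {n + 1} (X [ tmp d ≔ X (tmp d) + X (tmp d) ])
              (trans (update-same X (tmp d) _) (cong₂ _+_ eq eq))
  ... | X″ , b , v , f =
    X″ , (λ xs → block-++ {c = _ ∷ []} (block-op (add (tmp d) (tmp d) (tmp d)) refl) (b xs)) , v
       , agree-trans {X″ = X″} (agree-update d X _) f
  last : ∀ {n v} X → X (tmp d) ≡ v →
         Computes n (op (const (tmp (suc d)) (2 + toℕ a)) ∷ op (add (tmp d) (tmp d) (tmp (suc d))) ∷ [])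
                  2 d X (v + (2 + toℕ a))
  last X eq = X″ , (λ xs → block-++ {c = _ ∷ []} (block-op (const (tmp (suc d)) _) refl)
                                    (block-op (add (tmp d) (tmp d) (tmp (suc d))) refl))
              , trans (update-same X′ (tmp d) _)
                  (cong₂ _+_ (trans (agree-tmp (agree-update (suc d) X _)) eq)
                             (update-same X (tmp (suc d)) _))
              , agree-trans {X″ = X″} (agree-weaken {X′ = X′} (agree-update (suc d) X _)) (agree-update d X′ _)
    where
    X′ X″ : Reg → ℕ
    X′ = X [ tmp (suc d) ≔ 2 + toℕ a ]
    X″ = X′ [ tmp d ≔ X′ (tmp d) + X′ (tmp (suc d)) ]

binary-correct : ∀ {n c c′ t t′ d X v v′} (o : Reg → Reg → Reg → Op) (_∙_ : ℕ → ℕ → ℕ) →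
  (∀ {n X xs} i j k → exec (o i j k) (state n X xs) ≡ state (suc n) (X [ i ≔ X j ∙ X k ]) xs) →
  Computes n c t d X v →
  (∀ {n X′} → Agree d X X′ → Computes n c′ t′ (suc d) X′ v′) →
  Computes n (c ++ (c′ ++ op (o (tmp d) (tmp d) (tmp (suc d))) ∷ [])) (t + (t′ + 1)) d X (v ∙ v′)
binary-correct {n} {c} {c′} {d = d} {X} o _∙_ ex (X₁ , b₁ , v₁ , f₁) next with next {n + length c} f₁
... | X₂ , b₂ , v₂ , f₂ =
  _ , (λ xs → block-++ (b₁ xs) (block-++ {c = c′} (b₂ xs) (block-op (o (tmp d) (tmp d) (tmp (suc d))) (ex _ _ _))))
  , trans (update-same X₂ (tmp d) _) (cong₂ _∙_ (trans (agree-tmp {X′ = X₂} f₂) v₁) v₂)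
  , agree-trans {X′ = X₂} (agree-trans {X″ = X₂} f₁ (agree-weaken {X′ = X₂} f₂)) (agree-update d X₂ _)

compileExp-correct : ∀ e n d {X σ} → Represents X σ →
                     Computes n (compileExp e d) (expCost e) d X (eval e σ)
compileExp-correct (con v) n d {X} rep =
  _ , (λ xs → block-op (const (tmp d) v) refl) , update-same X (tmp d) v , agree-update d X v
compileExp-correct (e ⊕ e′) n d rep =
  binary-correct {c = compileExp e d} add _+_ (λ _ _ _ → refl) (compileExp-correct e n d rep)
    (λ {_} {X′} f → compileExp-correct e′ _ (suc d) (represents-agree {X′ = X′} f rep))
compileExp-correct (e ⊖ e′) n d rep =
  binary-correct {c = compileExp e d} sub _∸_ (λ _ _ _ → refl) (compileExp-correct e n d rep)
    (λ {_} {X′} f → compileExp-correct e′ _ (suc d) (represents-agree {X′ = X′} f rep))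
compileExp-correct (a ! e) n d {σ = σ} rep with compileExp-correct e n d rep
... | X₁ , b₁ , v₁ , f₁ with locate-correct (n + length (compileExp e d)) a d X₁ (eval e σ) v₁
... | X₂ , b₂ , v₂ , f₂ =
  _ , (λ xs → block-++ (b₁ xs) (block-++ {c = locate a d} (b₂ xs) (block-op (load (tmp d) (tmp d)) refl)))
  , trans (update-same X₂ (tmp d) _) (trans (cong X₂ v₂) (represents-agree {X′ = X₂} f (rep) a (eval e σ)))
  , agree-trans {X′ = X₂} f (agree-update d X₂ _)
  where
  f : Agree d _ X₂
  f = agree-trans {X″ = X₂} f₁ f₂

represents-set : ∀ {X σ} a i v → Represents X σ → Represents (X [ cell a i ≔ v ]) (set σ a i v)
represents-set {X} {σ} a i v rep b j with Data.Fin.Properties._≟_ b a | j Data.Nat.Properties.≟ i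
... | yes refl | yes refl rewrite ≡ᵇ-refl (toℕ a) | ≡ᵇ-refl i = update-same X (cell a i) v
... | yes refl | no j≢i rewrite ≡ᵇ-refl (toℕ a) | ≢⇒≡ᵇ j≢i =
  trans (update-other X v (λ eq → j≢i (proj₂ (reg-injective (suc (suc a)) (suc (suc a)) eq)))) (rep a j)
... | no b≢a | _ rewrite ≢⇒≡ᵇ (λ eq → b≢a (toℕ-injective eq)) =
  trans (update-other X v
          (λ eq → b≢a (lemma (proj₁ (reg-injective (suc (suc b)) (suc (suc a)) {j} {i} eq)))))
        (rep b j)
  where
  lemma : ∀ {n} {i j : Fin n} → Fin.suc (suc i) ≡ suc (suc j) → i ≡ j
  lemma refl = refl

-- Simulation of commands

-- Counters below d belong to the enclosing loops and must survive. Nothing is promised about the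
-- stack, which holds no live value between commands.
Executes : Cmd → ℕ → ℕ → (Reg → ℕ) → Mem → Set
Executes c n d X μ =
  ∃[ X′ ] Block n (compile c n d) X (proj₂ μ) (cost c μ) X′ (proj₂ (⟦ c ⟧ μ))
        × Represents X′ (proj₁ (⟦ c ⟧ μ)) × (∀ j → j < d → X′ (ctr j) ≡ X (ctr j))

agree-ctr : ∀ {d X X′} → Agree d X X′ → ∀ j → X′ (ctr j) ≡ X (ctr j)
agree-ctr f j = f _ (λ i _ → ctr≢tmp j i)

-- Induction on the count held in `ctr d`, started at the test in the foot. The correctness of the
-- body is a hypothesis, so that the recursion in `compile-correct` stays structural.
loop-correct : ∀ c nb d →
  (∀ {X μ} → Represents X (proj₁ μ) → Executes c nb (suc d) X μ) →
  ∀ k X μ → Represents X (proj₁ μ) → X (ctr d) ≡ k →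
  let len = length (compile c nb (suc d)); test = nb + len + 2 in
  ∃[ X′ ] (∀ {p} → CodeAt p nb (compile c nb (suc d) ++ loopFoot nb d) →
           Reaches p (state test X (proj₂ μ)) (loopCost (cost c) ⟦ c ⟧ k μ + 1)
                     (state (suc test) X′ (proj₂ (iter k ⟦ c ⟧ μ))))
        × Represents X′ (proj₁ (iter k ⟦ c ⟧ μ)) × (∀ j → j < d → X′ (ctr j) ≡ X (ctr j))
loop-correct c nb d body = go
  where
  len test : ℕ
  len  = length (compile c nb (suc d))
  test = nb + len + 2
  footAt : ∀ {p} → CodeAt p nb (compile c nb (suc d) ++ loopFoot nb d) →
           CodeAt p (nb + len) (loopFoot nb d)
  footAt at = proj₂ (codeAt-++⁻ nb (compile c nb (suc d)) at)
  testAt : ∀ {p} → CodeAt p nb (compile c nb (suc d) ++ loopFoot nb d) →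
           fetch p test ≡ just (op (jump nb (ctr d)))
  testAt {p} at = subst (λ n → fetch p n ≡ just (op (jump nb (ctr d)))) (sym (+-comm (nb + len) 2))
    (proj₁ (proj₂ (proj₂ (footAt at))))
  go : ∀ k X μ → Represents X (proj₁ μ) → X (ctr d) ≡ k →
       ∃[ X′ ] (∀ {p} → CodeAt p nb (compile c nb (suc d) ++ loopFoot nb d) →
                Reaches p (state test X (proj₂ μ)) (loopCost (cost c) ⟦ c ⟧ k μ + 1)
                          (state (suc test) X′ (proj₂ (iter k ⟦ c ⟧ μ))))
             × Represents X′ (proj₁ (iter k ⟦ c ⟧ μ)) × (∀ j → j < d → X′ (ctr j) ≡ X (ctr j))
  go zero X μ rep eq =
    X , (λ {p} at → subst (Reaches p s 1) leave (reaches-step s (testAt at))) , rep , (λ _ _ → refl)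
    where
    s : State
    s = state test X (proj₂ μ)
    leave : exec (jump nb (ctr d)) s ≡ state (suc test) X (proj₂ μ)
    leave rewrite eq = refl
  go (suc k) X μ rep eq with body {X} {μ} rep
  ... | X₁ , b , rep₁ , keep with go k X₃ (⟦ c ⟧ μ) rep₃ down
    where
    X₂ X₃ : Reg → ℕ
    X₂ = X₁ [ tmp 0 ≔ 1 ]
    X₃ = X₂ [ ctr d ≔ X₂ (ctr d) ∸ X₂ (tmp 0) ]
    rep₂ : Represents X₂ (proj₁ (⟦ c ⟧ μ))
    rep₂ = represents-agree {X′ = X₂} (agree-update 0 X₁ 1) rep₁
    rep₃ : Represents X₃ (proj₁ (⟦ c ⟧ μ))
    rep₃ a i = trans (update-other X₂ _ (cell≢ctr a i d)) (rep₂ a i)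
    down : X₃ (ctr d) ≡ k
    down = trans (update-same X₂ (ctr d) _)
             (cong₂ _∸_ (trans (agree-ctr {X′ = X₂} (agree-update 0 X₁ 1) d) (trans (keep d ≤-refl) eq))
                        (update-same X₁ (tmp 0) 1))
  ... | X′ , r , rep′ , keep′ =
    X′ , (λ {p} at → subst (λ t → Reaches p s t s″) timing
           (reaches-trans {t = 1} (enter at) (reaches-trans {t = cost c μ}
             (b (proj₁ (codeAt-++⁻ nb (compile c nb (suc d)) at)))
             (reaches-trans {t = 1} (reaches-step s₁ (proj₁ (footAt at)))
               (reaches-trans {t = 1} (reaches-step s₂ (proj₁ (proj₂ (footAt at)))) (back at))))))
       , rep′ , (λ j j<d → trans (keep′ j j<d) (trans (kept j j<d) (keep j (m<n⇒m<1+n j<d))))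
    where
    X₂ X₃ : Reg → ℕ
    X₂ = X₁ [ tmp 0 ≔ 1 ]
    X₃ = X₂ [ ctr d ≔ X₂ (ctr d) ∸ X₂ (tmp 0) ]
    xs : List ℕ
    xs = proj₂ (⟦ c ⟧ μ)
    s s₁ s₂ s″ : State
    s = state test X (proj₂ μ)
    s₁ = state (nb + len) X₁ xs
    s₂ = state (suc (nb + len)) X₂ xs
    s″ = state (suc test) X′ (proj₂ (iter k ⟦ c ⟧ (⟦ c ⟧ μ)))
    L : ℕ
    L = loopCost (cost c) ⟦ c ⟧ k (⟦ c ⟧ μ)
    enter : ∀ {p} → CodeAt p nb (compile c nb (suc d) ++ loopFoot nb d) →
            Reaches p s 1 (state nb X (proj₂ μ))
    enter {p} at = subst (Reaches p s 1) taken (reaches-step s (testAt at))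
      where
      taken : exec (jump nb (ctr d)) s ≡ state nb X (proj₂ μ)
      taken rewrite eq = refl
    back : ∀ {p} → CodeAt p nb (compile c nb (suc d) ++ loopFoot nb d) →
           Reaches p (state (suc (suc (nb + len))) X₃ xs) (L + 1) s″
    back {p} at = subst (λ n → Reaches p (state n X₃ xs) (L + 1) s″) (+-comm (nb + len) 2) (r at)
    timing : 1 + (cost c μ + (1 + (1 + (L + 1)))) ≡ cost c μ + 3 + L + 1
    timing = arith (cost c μ) L
      where
      arith : ∀ a l → 1 + (a + (1 + (1 + (l + 1)))) ≡ a + 3 + l + 1
      arith = solve-∀
    kept : ∀ j → j < d → X₃ (ctr j) ≡ X₁ (ctr j)
    kept j j<d = trans (update-other X₂ _ (λ eq → <⇒≢ j<d (proj₂ (reg-injective (suc zero) (suc zero) eq))))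
                       (agree-ctr {X′ = X₂} (agree-update 0 X₁ 1) j)

compile-correct : ∀ c n d {X μ} → Represents X (proj₁ μ) → Executes c n d X μ
compile-correct (a ⟨ e ⟩≔ e′) n d {X} {σ , xs} rep
  with compileExp-correct e n 0 rep
... | X₁ , b₁ , v₁ , f₁
  with locate-correct (n + length (compileExp e 0)) a 0 X₁ (eval e σ) v₁
... | X₂ , b₂ , v₂ , f₂
  -- Depth 1, so that the address already computed in `tmp 0` survives.
  with compileExp-correct e′ (n + length (compileExp e 0) + 7) 1
         (represents-agree {X′ = X₂} (agree-trans {X″ = X₂} f₁ f₂) rep)
... | X₃ , b₃ , v₃ , f₃ =
  X₄ , block-++ (b₁ xs) (block-++ {c = locate a 0} (b₂ xs)
         (block-++ {c = compileExp e′ 1} (b₃ xs) (block-op (store (tmp 0) (tmp 1)) ex)))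
  , represents-set {X₃} a (eval e σ) (eval e′ σ) (represents-agree {X = X} {X′ = X₃} f rep)
  , (λ j _ → trans (update-other X₃ (eval e′ σ) (λ eq → cell≢ctr a (eval e σ) j (sym eq)))
                   (agree-ctr {X′ = X₃} f j))
  where
  X₄ : Reg → ℕ
  X₄ = X₃ [ cell a (eval e σ) ≔ eval e′ σ ]
  f : Agree 0 X X₃
  f = agree-trans {X″ = X₃} (agree-trans {X″ = X₂} f₁ f₂) (agree-weaken {X′ = X₃} f₃)
  ex : ∀ {n} → exec (store (tmp 0) (tmp 1)) (state n X₃ xs) ≡ state (suc n) X₄ xs
  ex {n} = cong₂ (λ i v → state (suc n) (X₃ [ i ≔ v ]) xs) (trans (agree-tmp {X′ = X₃} f₃) v₂) v₃
compile-correct (get a) n d {X} {σ , xs} rep =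
  _ , block-op (read (cell a 0)) (ex xs) , represents-set {X} a 0 (first xs) rep
  , (λ j _ → update-other X (first xs) (λ eq → cell≢ctr a 0 j (sym eq)))
  where
  ex : ∀ xs → exec (read (cell a 0)) (state n X xs)
            ≡ state (suc n) (X [ cell a 0 ≔ first xs ]) (drop 1 xs)
  ex []       = refl
  ex (x ∷ xs) = refl
compile-correct (c ▸ c′) n d rep with compile-correct c n d rep
... | X₁ , b₁ , rep₁ , keep₁ with compile-correct c′ (n + length (compile c n d)) d rep₁
... | X₂ , b₂ , rep₂ , keep₂ =
  X₂ , block-++ {c = compile c n d} b₁ b₂ , rep₂ , (λ j j<d → trans (keep₂ j j<d) (keep₁ j j<d))
compile-correct (for e c) n d {X} {σ , xs} rep
  with compileExp-correct e n 0 rep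
... | X₁ , b₁ , v₁ , f₁ = execute
  where
  k nb len test : ℕ
  k    = eval e σ
  nb   = n + length (compileExp e 0) + 4
  len  = length (compile c nb (suc d))
  test = nb + len + 2
  X₂ X₃ X₄ : Reg → ℕ
  X₂ = X₁ [ tmp 1 ≔ 0 ]
  X₃ = X₂ [ ctr d ≔ X₂ (tmp 0) + X₂ (tmp 1) ]
  X₄ = X₃ [ tmp 0 ≔ 1 ]
  rep₂ : Represents X₂ σ
  rep₂ = represents-agree {X′ = X₂} (agree-update 1 X₁ 0) (represents-agree {X′ = X₁} f₁ rep)
  rep₃ : Represents X₃ σ
  rep₃ a i = trans (update-other X₂ _ (cell≢ctr a i d)) (rep₂ a i)
  counter : X₄ (ctr d) ≡ k
  counter = trans (agree-ctr {X′ = X₄} (agree-update 0 X₃ 1) d) (trans (update-same X₂ (ctr d) _)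
    (trans (cong₂ _+_ (trans (agree-tmp {X′ = X₂} (agree-update 1 X₁ 0)) v₁) (update-same X₁ (tmp 1) 0))
           (+-identityʳ k)))
  kept : ∀ j → j < d → X₄ (ctr j) ≡ X (ctr j)
  kept j j<d = trans (agree-ctr {X′ = X₄} (agree-update 0 X₃ 1) j)
    (trans (update-other X₂ _ (λ eq → <⇒≢ j<d (proj₂ (reg-injective (suc zero) (suc zero) eq))))
    (trans (agree-ctr {X′ = X₂} (agree-update 1 X₁ 0) j) (agree-ctr {X′ = X₁} f₁ j)))
  execute : Executes (for e c) n d X (σ , xs)
  execute with loop-correct c nb d (λ {X} {μ} → compile-correct c nb (suc d) {X} {μ}) k X₄ (σ , xs)
                 (represents-agree {X = X₃} {X′ = X₄} (agree-update 0 X₃ 1) rep₃) counter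
  ... | X′ , r , rep′ , keep′ =
    X′ , block , rep′ , (λ j j<d → trans (keep′ j j<d) (kept j j<d))
    where
    L : ℕ
    L = loopCost (cost c) ⟦ c ⟧ k (σ , xs)
    xs′ : List ℕ
    xs′ = proj₂ (iter k ⟦ c ⟧ (σ , xs))
    block : Block n (compile (for e c) n d) X xs (cost (for e c) (σ , xs)) X′ xs′
    block {p} at
      with codeAt-++⁻ n (compileExp e 0) at
    ... | at₁ , at₂@(h₁ , h₂ , h₃ , h₄ , _)
      with codeAt-++⁻ (n + length (compileExp e 0)) (loopHead test d) at₂
    ... | _ , at₃ =
      subst₂ (λ t n′ → Reaches p (state n X xs) t (state n′ X′ xs′)) timing place
        (reaches-trans {t = expCost e + (1 + (1 + 1))} (reaches-trans {t = expCost e} (b₁ xs at₁)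
           (reaches-trans {t = 1} (reaches-step _ h₁)
             (reaches-trans {t = 1} (reaches-step _ h₂) (reaches-step _ h₃))))
          (reaches-trans {t = 1} (subst (Reaches p s₄ 1) taken (reaches-step s₄ h₄)) (r at₃)))
      where
      s₄ : State
      s₄ = state (3 + (n + length (compileExp e 0))) X₄ xs
      taken : exec (jump test (tmp 0)) s₄ ≡ state test X₄ xs
      taken rewrite update-same X₃ (tmp 0) 1 = refl
      timing : expCost e + 3 + (1 + (L + 1)) ≡ expCost e + 4 + (L + 1)
      timing = arith (expCost e) L
        where
        arith : ∀ a l → a + 3 + (1 + (l + 1)) ≡ a + 4 + (l + 1)
        arith = solve-∀
      place : suc test ≡ n + length (compile (for e c) n d)
      place = trans (arith n (length (compileExp e 0)) len)
        (cong (n +_) (sym (trans (length-++ (compileExp e 0))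
          (cong (λ l → length (compileExp e 0) + (4 + l)) (length-++ (compile c nb (suc d)))))))
        where
        arith : ∀ n e l → suc (n + e + 4 + l + 2) ≡ n + (e + (4 + (l + 3)))
        arith = solve-∀

-- Programs that compute and then answer whether an expression is positive

program : Cmd → Exp → Program
program c e = compile c 0 0 ++ (compileExp e 0 ++
  op (jump (length (compile c 0 0) + length (compileExp e 0) + 2) (tmp 0)) ∷ halt false ∷ halt true ∷ [])

start : List ℕ → Mem
start xs = (λ _ _ → 0) , xs

answer-correct : ∀ p n X xs r v →
  CodeAt p n (op (jump (n + 2) r) ∷ halt false ∷ halt true ∷ []) → X r ≡ v →
  run p 2 (state n X xs) ≡ just (0 <ᵇ v)
answer-correct p n X xs r zero    (h₁ , h₂ , _)      eq rewrite h₁ | eq | h₂ = refl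
answer-correct p n X xs r (suc v) (h₁ , h₂ , h₃ , _) eq rewrite h₁ | eq | +-comm n 2 | h₃ = refl

program-correct : ∀ c e xs →
  run (program c e) (cost c (start xs) + (expCost e + 2)) (initial xs)
  ≡ just (0 <ᵇ eval e (proj₁ (⟦ c ⟧ (start xs))))
program-correct c e xs = run-exp (compile-correct c 0 0 (λ _ _ → refl))
  where
  n m t : ℕ
  n = length (compile c 0 0)
  m = n + length (compileExp e 0)
  t = cost c (start xs)
  σ : Store
  σ = proj₁ (⟦ c ⟧ (start xs))
  at : CodeAt (program c e) n (compileExp e 0 ++
         op (jump (m + 2) (tmp 0)) ∷ halt false ∷ halt true ∷ [])
  at = proj₂ (codeAt-++⁻ 0 (compile c 0 0) (codeAt-self (program c e)))
  run-exp : Executes c 0 0 (λ _ → 0) (start xs) →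
    run (program c e) (t + (expCost e + 2)) (initial xs) ≡ just (0 <ᵇ eval e σ)
  run-exp (X₁ , b₁ , rep₁ , _) = go (compileExp-correct e n 0 rep₁)
    where
    go : Computes n (compileExp e 0) (expCost e) 0 X₁ (eval e σ) →
         run (program c e) (t + (expCost e + 2)) (initial xs) ≡ just (0 <ᵇ eval e σ)
    go (X₂ , b₂ , v₂ , _) =
      trans (b₁ (proj₁ (codeAt-++⁻ 0 (compile c 0 0) (codeAt-self (program c e)))) .follow (expCost e + 2))
        (trans (b₂ _ (proj₁ (codeAt-++⁻ n (compileExp e 0) at)) .follow 2)
          (answer-correct (program c e) m X₂ _ (tmp 0) (eval e σ)
            (proj₂ (codeAt-++⁻ n (compileExp e 0) at)) v₂))

-- Codes of unordered pairs

tri : ℕ → ℕ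
tri zero    = 0
tri (suc n) = suc n + tri n

tri-mono : ∀ {m n} → m ≤ n → tri m ≤ tri n
tri-mono z≤n       = z≤n
tri-mono (s≤s m≤n) = +-mono-≤ (s≤s m≤n) (tri-mono m≤n)

-- The position of the unordered pair when pairs are listed by larger and then by smaller element.
-- Pairs of numbers below n thus get exactly the codes below `tri n`; this compactness keeps the
-- number of kinds near K⁴/8.
pair : ℕ → ℕ → ℕ
pair u v = tri (u ⊔ v) + u ⊓ v

tri+<tri : ∀ {m k} → k ≤ m → tri m + k < tri (suc m)
tri+<tri {m} {k} k≤m = ≤-trans (s≤s (≤-trans (+-monoʳ-≤ (tri m) k≤m) (≤-reflexive (+-comm (tri m) m)))) ≤-refl

-- The intervals from `tri m` to `tri m + m` are disjoint.
tri+-injective : ∀ {m m′ k k′} → k ≤ m → k′ ≤ m′ → tri m + k ≡ tri m′ + k′ → m ≡ m′ × k ≡ k′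
tri+-injective {m} {m′} {k} {k′} k≤m k′≤m′ eq with <-cmp m m′
... | tri< m<m′ _ _ = ⊥-elim (<⇒≢ (<-≤-trans (tri+<tri k≤m) (≤-trans (tri-mono m<m′) (m≤m+n _ k′))) eq)
... | tri≈ _ refl _ = refl , +-cancelˡ-≡ (tri m) k k′ eq
... | tri> _ _ m′<m = ⊥-elim (<⇒≢ (<-≤-trans (tri+<tri k′≤m′) (≤-trans (tri-mono m′<m) (m≤m+n _ k))) (sym eq))

pair-comm : ∀ u v → pair u v ≡ pair v u
pair-comm u v = cong₂ (λ m k → tri m + k) (⊔-comm u v) (⊓-comm u v)

pair-injective : ∀ u v u′ v′ → pair u v ≡ pair u′ v′ → (u ≡ u′ × v ≡ v′) ⊎ (u ≡ v′ × v ≡ u′)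
pair-injective u v u′ v′ eq
  with tri+-injective (≤-trans (m⊓n≤m u v) (m≤m⊔n u v)) (≤-trans (m⊓n≤m u′ v′) (m≤m⊔n u′ v′)) eq
... | max , min with ≤-total u v | ≤-total u′ v′
... | inj₁ h | inj₁ h′ = inj₁ (trans (sym (m≤n⇒m⊓n≡m h)) (trans min (m≤n⇒m⊓n≡m h′))
                             , trans (sym (m≤n⇒m⊔n≡n h)) (trans max (m≤n⇒m⊔n≡n h′)))
... | inj₁ h | inj₂ h′ = inj₂ (trans (sym (m≤n⇒m⊓n≡m h)) (trans min (m≥n⇒m⊓n≡n h′))
                             , trans (sym (m≤n⇒m⊔n≡n h)) (trans max (m≥n⇒m⊔n≡m h′)))
... | inj₂ h | inj₁ h′ = inj₂ (trans (sym (m≥n⇒m⊔n≡m h)) (trans max (m≤n⇒m⊔n≡n h′))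
                             , trans (sym (m≥n⇒m⊓n≡n h)) (trans min (m≤n⇒m⊓n≡m h′)))
... | inj₂ h | inj₂ h′ = inj₁ (trans (sym (m≥n⇒m⊔n≡m h)) (trans max (m≥n⇒m⊔n≡m h′))
                             , trans (sym (m≥n⇒m⊓n≡n h)) (trans min (m≥n⇒m⊓n≡n h′)))

pair-bound : ∀ {u v n} → u < n → v < n → pair u v < tri n
pair-bound {u} {v} u<n v<n =
  <-≤-trans (tri+<tri (≤-trans (m⊓n≤m u v) (m≤m⊔n u v))) (tri-mono (⊔-lub u<n v<n))

-- Rows of kinds

-- The kind of a piece records its two pairs of opposite colours without
-- order: exactly what matters once rotations are allowed.
kindOf : (r t l b : ℕ) → ℕ
kindOf r t l b = pair (pair r l) (pair t b)

-- Writing the pair that is walked along first loses nothing, since the outer `pair` is symmetric.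
record Fits (z l r : ℕ) : Set where
  constructor fits
  field
    other : ℕ
    splits : z ≡ pair (pair l r) other

fits-flip : ∀ {z l r} → Fits z l r → Fits z r l
fits-flip {l = l} {r} (fits w eq) = fits w (trans eq (cong (λ p → pair p w) (pair-comm l r)))

-- (left, right) after k quarter turns.
sides : (r t l b : ℕ) → Fin 4 → ℕ × ℕ
sides r t l b zero                   = l , r
sides r t l b (suc zero)             = t , b
sides r t l b (suc (suc zero))       = r , l
sides r t l b (suc (suc (suc zero))) = b , t

fits-sides : ∀ r t l b k → let (x , y) = sides r t l b k in Fits (kindOf r t l b) x y
fits-sides r t l b zero                   = fits-flip (fits _ refl)
fits-sides r t l b (suc zero)             = fits _ (pair-comm (pair r l) (pair t b))
fits-sides r t l b (suc (suc zero))       = fits _ refl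
fits-sides r t l b (suc (suc (suc zero))) = fits-flip (fits _ (pair-comm (pair r l) (pair t b)))

-- The outer code tells which pair lies horizontally, the inner one in which direction; the four
-- outcomes are the four quarter turns.
fits⇒sides : ∀ r t l b {x y} → Fits (kindOf r t l b) x y → ∃[ k ] sides r t l b k ≡ (x , y)
fits⇒sides r t l b {x} {y} (fits w eq) with pair-injective (pair r l) (pair t b) (pair x y) w eq
... | inj₁ (eq′ , _) with pair-injective r l x y eq′
...   | inj₁ (refl , refl) = suc (suc zero) , refl
...   | inj₂ (refl , refl) = zero , refl
fits⇒sides r t l b {x} {y} (fits w eq) | inj₂ (_ , eq′) with pair-injective t b x y eq′
...   | inj₁ (refl , refl) = suc zero , refl
...   | inj₂ (refl , refl) = suc (suc (suc zero)) , refl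

record Tile : Set where
  constructor tile
  field
    kind from to : ℕ

open Tile

data Path : ℕ → List Tile → ℕ → Set where
  []  : ∀ {c} → Path c [] c
  _∷_ : ∀ {z l r ds c} → Fits z l r → Path r ds c → Path l (tile z l r ∷ ds) c

-- The empty list has a row from every colour; hence row 0 of the table `ways` consists of ones.
RowFrom : ℕ → List ℕ → Set
RowFrom c zs = ∃[ ds ] ∃[ c′ ] Path c ds c′ × map kind ds ↭ zs

Row : List ℕ → Set
Row zs = ∃[ c ] RowFrom c zs

row-resp-↭ : ∀ {zs zs′} → zs ↭ zs′ → Row zs → Row zs′
row-resp-↭ p (c , ds , c′ , path , q) = c , ds , c′ , path , ↭-trans q p

path-++ : ∀ {a b c xs ys} → Path a xs b → Path b ys c → Path a (xs ++ ys) c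
path-++ []       q = q
path-++ (f ∷ p) q = f ∷ path-++ p q

path-split : ∀ {a c} xs {ys} → Path a (xs ++ ys) c → ∃[ b ] Path a xs b × Path b ys c
path-split []       p = _ , [] , p
path-split (x ∷ xs) (f ∷ p) with path-split xs p
... | b , p₁ , p₂ = b , f ∷ p₁ , p₂

flip : Tile → Tile
flip (tile z l r) = tile z r l

turned : List Tile → List Tile
turned []       = []
turned (d ∷ ds) = turned ds ++ flip d ∷ []

path-turned : ∀ {a b ds} → Path a ds b → Path b (turned ds) a
path-turned []      = []
path-turned (f ∷ p) = path-++ (path-turned p) (fits-flip f ∷ [])

kinds-turned : ∀ ds → map kind (turned ds) ↭ map kind ds
kinds-turned []       = ↭-refl
kinds-turned (d ∷ ds) = ↭-trans (↭-reflexive (map-++ kind (turned ds) _))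
  (↭-trans (++-comm (map kind (turned ds)) _) (↭-prep _ (kinds-turned ds)))

path-fits : ∀ {a b ds} → Path a ds b → All (λ d → Fits (kind d) (from d) (to d)) ds
path-fits []      = []
path-fits (f ∷ p) = f ∷ path-fits p

-- Reversing the stretch between two equal tiles and its first tile lets
-- both tiles be dropped.
path-excise : ∀ {a c} A {z l r} B {C} → Path a (A ++ tile z l r ∷ B ++ tile z l r ∷ C) c →
              Path a (A ++ turned B ++ C) c
path-excise A B p with path-split A p
... | _ , p₁ , (_ ∷ p₂) with path-split B p₂
... | _ , p₃ , (_ ∷ p₄) = path-++ p₁ (path-++ (path-turned p₃) p₄)

-- The occurrence found first may be the left or the right one of the two, hence the two cases.
find-two : ∀ {A : Set} {x : A} {xs ys} → xs ↭ x ∷ x ∷ ys →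
           ∃[ as ] ∃[ bs ] ∃[ cs ] xs ≡ as ++ x ∷ bs ++ x ∷ cs × as ++ bs ++ cs ↭ ys
find-two {x = x} {ys = ys} p with ∈-∃++ (∈-resp-↭ (↭-sym p) (here refl))
... | as , cs , refl with drop-mid as [] {zs = x ∷ ys} p
... | q with ∈-++⁻ as (∈-resp-↭ (↭-sym q) (here refl))
... | inj₁ x∈as with ∈-∃++ x∈as
...   | as₁ , as₂ , refl =
  as₁ , as₂ , cs , ++-assoc as₁ (x ∷ as₂) (x ∷ cs)
  , drop-mid as₁ [] (↭-trans (↭-reflexive (sym (++-assoc as₁ (x ∷ as₂) cs))) q)
find-two {x = x} {ys = ys} p | as , cs , refl | q | inj₂ x∈cs with ∈-∃++ x∈cs
...   | cs₁ , cs₂ , refl =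
  as , cs₁ , cs₂ , refl
  , ↭-trans (↭-reflexive (sym (++-assoc as cs₁ cs₂)))
      (drop-mid (as ++ cs₁) [] (↭-trans (↭-reflexive (++-assoc as cs₁ (x ∷ cs₂))) q))

pull : ∀ {A : Set} (xs : List A) i → ∃[ ys ] xs ↭ lookup xs i ∷ ys
pull (x ∷ xs) zero    = xs , ↭-refl
pull (x ∷ xs) (suc i) with pull xs i
... | ys , p = x ∷ ys , ↭-trans (↭-prep x p) (↭-swap x _ ↭-refl)

lookup-two : ∀ {A : Set} (xs : List A) {i j} → i Fin.< j → lookup xs i ≡ lookup xs j →
             ∃[ ys ] xs ↭ lookup xs i ∷ lookup xs i ∷ ys
lookup-two (x ∷ xs) {zero} {suc j} _ eq with pull xs j
... | ys , p = ys , ↭-prep x (subst (λ y → xs ↭ y ∷ ys) (sym eq) p)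
lookup-two (x ∷ xs) {suc i} {suc j} (s≤s i<j) eq with lookup-two xs i<j eq
... | ys , p = x ∷ ys , ↭-trans (↭-prep x p) (↭-trans (↭-swap x _ ↭-refl) (↭-prep _ (↭-swap x _ ↭-refl)))

-- `path-excise` needs two equal tiles, not merely tiles of one kind. All five kinds come from the
-- same r, t, l, b, so equal turns give equal `from` and `to`.
row-drop-two : ∀ {z zs} r t l b → z ≡ kindOf r t l b →
               Row (z ∷ z ∷ z ∷ z ∷ z ∷ zs) → Row (z ∷ z ∷ z ∷ zs)
row-drop-two {z} {zs} r t l b eq (c , ds , c′ , path , p) with ↭-map-inv kind p
... | (tile _ l₀ r₀ ∷ tile _ l₁ r₁ ∷ tile _ l₂ r₂ ∷ tile _ l₃ r₃ ∷ tile _ l₄ r₄ ∷ ds′) , refl , q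
  with All-resp-↭ q (path-fits path)
... | f₀ ∷ f₁ ∷ f₂ ∷ f₃ ∷ f₄ ∷ _ = go (pigeonhole (n<1+n 4) (λ i → proj₁ (turn i)))
  where
  used : List Tile
  used = tile z l₀ r₀ ∷ tile z l₁ r₁ ∷ tile z l₂ r₂ ∷ tile z l₃ r₃ ∷ tile z l₄ r₄ ∷ []
  turning : ∀ {x y} → Fits z x y → ∃[ k ] sides r t l b k ≡ (x , y)
  turning f = fits⇒sides r t l b (subst (λ z → Fits z _ _) eq f)
  turn : (i : Fin 5) → ∃[ k ] sides r t l b k ≡ (from (lookup used i) , to (lookup used i))
  turn zero                         = turning f₀
  turn (suc zero)                   = turning f₁
  turn (suc (suc zero))             = turning f₂
  turn (suc (suc (suc zero)))       = turning f₃
  turn (suc (suc (suc (suc zero)))) = turning f₄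
  kind-used : ∀ i → kind (lookup used i) ≡ z
  kind-used zero                         = refl
  kind-used (suc zero)                   = refl
  kind-used (suc (suc zero))             = refl
  kind-used (suc (suc (suc zero)))       = refl
  kind-used (suc (suc (suc (suc zero)))) = refl
  same : ∀ i j → proj₁ (turn i) ≡ proj₁ (turn j) → lookup used i ≡ lookup used j
  same i j k≡k′ = cong₂ (λ z (x , y) → tile z x y) (trans (kind-used i) (sym (kind-used j)))
    (trans (sym (proj₂ (turn i))) (trans (cong (sides r t l b) k≡k′) (proj₂ (turn j))))
  go : (∃[ i ] ∃[ j ] i Fin.< j × proj₁ (turn i) ≡ proj₁ (turn j)) → Row (z ∷ z ∷ z ∷ zs)
  go (i , j , i<j , k≡k′) with lookup-two used i<j (same i j k≡k′)
  ... | ys , s with find-two (↭-trans q (++⁺ʳ ds′ s))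
  ... | A , B , C , refl , s′ =
    c , A ++ turned B ++ C , c′ , path-excise A B path
    , ↭-trans kinds-new (↭-trans (↭-map⁺ kind s′) kinds-rest)
    where
    kinds-new : map kind (A ++ turned B ++ C) ↭ map kind (A ++ B ++ C)
    kinds-new rewrite map-++ kind A (turned B ++ C) | map-++ kind (turned B) C
                    | map-++ kind A (B ++ C) | map-++ kind B C =
      ++⁺ˡ (map kind A) (++⁺ʳ (map kind C) (kinds-turned B))
    -- Both sides are compared after adding the two removed copies of z, which then cancel.
    kinds-rest : map kind (ys ++ ds′) ↭ z ∷ z ∷ z ∷ map kind ds′
    kinds-rest = drop-∷ (drop-∷ (↭-sym (subst (λ y → _ ↭ y ∷ y ∷ map kind (ys ++ ds′)) (kind-used i)
                   (↭-map⁺ kind (++⁺ʳ ds′ s)))))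

row-add-two : ∀ {z zs} → Row (z ∷ zs) → Row (z ∷ z ∷ z ∷ zs)
row-add-two {z} {zs} (c , ds , c′ , path , p) with ∈-map⁻ kind (∈-resp-↭ (↭-sym p) (here refl))
... | tile _ l r , d∈ds , refl with ∈-∃++ d∈ds
... | A , C , refl with path-split A path
... | _ , p₁ , (f ∷ p₂) =
  c , A ++ tile z l r ∷ tile z r l ∷ tile z l r ∷ C , c′
  , path-++ p₁ (f ∷ fits-flip f ∷ f ∷ p₂)
  , ↭-trans (↭-map⁺ kind (↭-trans (shift _ A _) (↭-prep _ (shift _ A _)))) (↭-prep z (↭-prep z p))

-- Puzzles as lists of kinds

colour : ∀ {K} → Fin K → ℕ
colour c = suc (toℕ c)

pieceKind : ∀ {K} → Piece K → ℕ
pieceKind (piece r t l b) = kindOf (colour r) (colour t) (colour l) (colour b)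

kinds : ∀ {K} → Puzzle K → List ℕ
kinds P = map (λ i → pieceKind (pieces P i)) (allFin (size P))

pieceSides : ∀ {K} → Piece K → Fin 4 → ℕ × ℕ
pieceSides (piece r t l b) = sides (colour r) (colour t) (colour l) (colour b)

sides-rotateBy : ∀ {K} (p : Piece K) k →
                 pieceSides p k ≡ (colour (left (rotateBy k p)) , colour (right (rotateBy k p)))
sides-rotateBy p zero                   = refl
sides-rotateBy p (suc zero)             = refl
sides-rotateBy p (suc (suc zero))       = refl
sides-rotateBy p (suc (suc (suc zero))) = refl

fits-rotateBy : ∀ {K} (p : Piece K) k →
                Fits (pieceKind p) (colour (left (rotateBy k p))) (colour (right (rotateBy k p)))
fits-rotateBy p@(piece r t l b) k =
  subst (λ (x , y) → Fits (pieceKind p) x y) (sides-rotateBy p k)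
        (fits-sides (colour r) (colour t) (colour l) (colour b) k)

fits⇒rotateBy : ∀ {K} (p : Piece K) {x y} → Fits (pieceKind p) x y →
                ∃[ k ] colour (left (rotateBy k p)) ≡ x × colour (right (rotateBy k p)) ≡ y
fits⇒rotateBy p@(piece r t l b) f
  with fits⇒sides (colour r) (colour t) (colour l) (colour b) f
... | k , eq = k , cong proj₁ eq′ , cong proj₂ eq′
  where
  eq′ = trans (sym (sides-rotateBy p k)) eq

-- Both lists are free of duplicates and have the same members, so they are equal as bags.
tabulate-permutation : ∀ {n} (π : Permutation′ n) → tabulate (π ⟨$⟩ʳ_) ↭ allFin n
tabulate-permutation π = ∼bag⇒↭ (unique∧set⇒bag (tabulate⁺ injective) (allFin⁺ _)
  (λ {i} → mk⇔ (λ _ → ∈-tabulate⁺ i)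
               (λ _ → subst (_∈ tabulate (π ⟨$⟩ʳ_)) (inverseʳ π) (∈-tabulate⁺ (π ⟨$⟩ˡ i)))))
  where
  injective : ∀ {i j} → π ⟨$⟩ʳ i ≡ π ⟨$⟩ʳ j → i ≡ j
  injective eq = trans (sym (inverseˡ π)) (trans (cong (π ⟨$⟩ˡ_) eq) (inverseˡ π))

path-tabulate : ∀ {n} (f : Fin n → Tile) →
  (∀ i → Fits (Tile.kind (f i)) (Tile.from (f i)) (Tile.to (f i))) →
  (∀ i j → toℕ j ≡ suc (toℕ i) → Tile.to (f i) ≡ Tile.from (f j)) →
  ∃[ c ] ∃[ c′ ] Path c (tabulate f) c′
path-tabulate {zero}  f fit match = 0 , 0 , []
path-tabulate {suc n} f fit match = _ , nonempty n f fit match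
  where
  nonempty : ∀ n (f : Fin (suc n) → Tile) →
    (∀ i → Fits (Tile.kind (f i)) (Tile.from (f i)) (Tile.to (f i))) →
    (∀ i j → toℕ j ≡ suc (toℕ i) → Tile.to (f i) ≡ Tile.from (f j)) →
    ∃[ c′ ] Path (Tile.from (f zero)) (tabulate f) c′
  nonempty zero    f fit match = _ , fit zero ∷ []
  nonempty (suc n) f fit match
    with nonempty n (λ i → f (suc i)) (λ i → fit (suc i))
                  (λ i j eq → match (suc i) (suc j) (cong suc eq))
  ... | c′ , p = c′ , fit zero ∷
    subst (λ c → Path c (tabulate (λ i → f (suc i))) c′) (sym (match zero (suc zero) refl)) p

path-lookup : ∀ {c c′ ds} → Path c ds c′ → ∀ i j → toℕ j ≡ suc (toℕ i) →
              Tile.to (lookup ds i) ≡ Tile.from (lookup ds j)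
path-lookup (_ ∷ (_ ∷ _)) zero    (suc zero) refl = refl
path-lookup (_ ∷ p)       (suc i) (suc j)    eq   = path-lookup p i j (suc-injective eq)
path-lookup (_ ∷ [])      zero    (suc ())   eq

path-lookup-fits : ∀ {c c′ ds} → Path c ds c′ → ∀ i →
  Fits (Tile.kind (lookup ds i)) (Tile.from (lookup ds i)) (Tile.to (lookup ds i))
path-lookup-fits (f ∷ _) zero    = f
path-lookup-fits (_ ∷ p) (suc i) = path-lookup-fits p i

map≡map⇒lookup : ∀ {A B C : Set} {f : A → C} {g : B → C} xs ys → map f xs ≡ map g ys →
                 ∀ i j → toℕ i ≡ toℕ j → f (lookup xs i) ≡ g (lookup ys j)
map≡map⇒lookup {f = f} {g} (x ∷ xs) (y ∷ ys) eq i j = go i j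
  where
  go : ∀ i j → toℕ i ≡ toℕ j → f (lookup (x ∷ xs) i) ≡ g (lookup (y ∷ ys) j)
  go zero    zero    _  = proj₁ (∷-injective eq)
  go (suc i) (suc j) i≡j = map≡map⇒lookup xs ys (proj₂ (∷-injective eq)) i j (suc-injective i≡j)

-- A permutation of lists acts on positions; π is the inverse of that action, between casts because
-- the lengths agree only propositionally.
enumeration : ∀ {n} (is : List (Fin n)) → allFin n ↭ is →
  ∃[ π ] ∀ (i : Fin n) (j : Fin (length is)) → toℕ i ≡ toℕ j → π ⟨$⟩ʳ i ≡ lookup is j
enumeration {n} is p = π , correct
  where
  len : length (allFin n) ≡ n
  len = length-tabulate (λ i → i)
  len′ : n ≡ length is
  len′ = trans (sym len) (↭-length p)
  ρ : Permutation (length (allFin n)) (length is)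
  ρ = onIndices (↭⇒↭ₛ p)
  π : Permutation′ n
  π = cast-id len′ ∘ₚ (inverse ρ ∘ₚ cast-id len)
  correct : ∀ i j → toℕ i ≡ toℕ j → π ⟨$⟩ʳ i ≡ lookup is j
  correct i j eq = begin
    cast len k                         ≡⟨ sym (lookup-tabulate (λ i → i) (cast len k)) ⟩
    lookup (allFin n) (cast (sym len) (cast len k)) ≡⟨ cong (lookup (allFin n)) (toℕ-injective
                                             (trans (toℕ-cast (sym len) _) (toℕ-cast len k))) ⟩
    lookup (allFin n) k                ≡⟨ onIndices-lookup (setoid (Fin n)) (↭⇒↭ₛ p) k ⟩
    lookup is (ρ ⟨$⟩ʳ k)                ≡⟨ cong (lookup is) (inverseʳ ρ) ⟩
    lookup is (cast len′ i)            ≡⟨ cong (lookup is) (toℕ-injective (trans (toℕ-cast len′ i) eq)) ⟩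
    lookup is j                        ∎
    where
    open ≡-Reasoning
    k : Fin (length (allFin n))
    k = ρ ⟨$⟩ˡ cast len′ i

solvable⇒row : ∀ {K} (P : Puzzle K) → Solvable P → Row (kinds P)
solvable⇒row P (pl , match) with path-tabulate tileAt fit (λ i j eq → cong colour (match i j eq))
  where
  open Placement pl
  tileAt : Fin (size P) → Tile
  tileAt i = tile (pieceKind (pieces P (order ⟨$⟩ʳ i)))
                  (colour (left (placedAt P pl i))) (colour (right (placedAt P pl i)))
  fit : ∀ i → Fits (Tile.kind (tileAt i)) (Tile.from (tileAt i)) (Tile.to (tileAt i))
  fit i = fits-rotateBy (pieces P (order ⟨$⟩ʳ i)) (rotation (order ⟨$⟩ʳ i))
... | c , c′ , path = c , _ , c′ , path , ↭-trans (↭-reflexive (trans (map-tabulate _ Tile.kind)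
      (sym (map-tabulate _ (λ i → pieceKind (pieces P i))))))
      (↭-map⁺ (λ i → pieceKind (pieces P i)) (tabulate-permutation (Placement.order pl)))

-- Turns are found cell by cell, whereas `Placement` indexes them by pieces; the inverse of π
-- translates.
solve : ∀ {K} (P : Puzzle K) (π : Permutation′ (size P)) (turn : Fin (size P) → Fin 4) →
  (∀ i j → toℕ j ≡ suc (toℕ i) → right (rotateBy (turn i) (pieces P (π ⟨$⟩ʳ i)))
                               ≡ left (rotateBy (turn j) (pieces P (π ⟨$⟩ʳ j)))) →
  Solvable P
solve P π turn match = pl , λ i j eq →
  trans (cong right (placed i)) (trans (match i j eq) (cong left (sym (placed j))))
  where
  pl : Placement (size P)
  pl = record { order = π ; rotation = λ i → turn (π ⟨$⟩ˡ i) }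
  placed : ∀ i → placedAt P pl i ≡ rotateBy (turn i) (pieces P (π ⟨$⟩ʳ i))
  placed i = cong (λ k → rotateBy k (pieces P (π ⟨$⟩ʳ i))) (cong turn (inverseˡ π))

-- Pieces of one kind are interchangeable, so `↭-map-inv` may lift the permutation of kinds to any
-- permutation of pieces above it; each piece is then turned to show the sides of its tile.
row⇒solvable : ∀ {K} (P : Puzzle K) → Row (kinds P) → Solvable P
row⇒solvable {K} P (c , ds , c′ , path , p) = build (↭-map-inv kindAt (↭-sym p))
  where
  kindAt : Fin (size P) → ℕ
  kindAt i = pieceKind (pieces P i)
  build : ∃[ is ] map Tile.kind ds ≡ map kindAt is × allFin (size P) ↭ is → Solvable P
  build (is , eq , q) = solve P π (λ i → proj₁ (turn i)) match
    where
    π : Permutation′ (size P)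
    π = proj₁ (enumeration is q)
    M : ℕ
    M = size P
    len : M ≡ length is
    len = trans (sym (length-tabulate {n = M} (λ i → i))) (↭-length q)
    len′ : M ≡ length ds
    len′ = trans len (trans (sym (length-map _ is)) (trans (cong length (sym eq)) (length-map Tile.kind ds)))
    tileAt : Fin M → Tile
    tileAt i = lookup ds (cast len′ i)
    sameKind : ∀ i → Tile.kind (tileAt i) ≡ pieceKind (pieces P (π ⟨$⟩ʳ i))
    sameKind i = trans (map≡map⇒lookup ds is eq (cast len′ i) (cast len i)
                       (trans (toℕ-cast len′ i) (sym (toℕ-cast len i))))
                     (cong (λ j → pieceKind (pieces P j))
                           (sym (proj₂ (enumeration is q) i (cast len i) (sym (toℕ-cast len i)))))
    turn : ∀ i → ∃[ k ] colour (left (rotateBy k (pieces P (π ⟨$⟩ʳ i)))) ≡ Tile.from (tileAt i)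
                      × colour (right (rotateBy k (pieces P (π ⟨$⟩ʳ i)))) ≡ Tile.to (tileAt i)
    turn i = fits⇒rotateBy (pieces P (π ⟨$⟩ʳ i))
               (subst (λ z → Fits z (Tile.from (tileAt i)) (Tile.to (tileAt i))) (sameKind i)
                      (path-lookup-fits path (cast len′ i)))
    match : ∀ i j → toℕ j ≡ suc (toℕ i) → right (rotateBy (proj₁ (turn i)) (pieces P (π ⟨$⟩ʳ i)))
                                        ≡ left (rotateBy (proj₁ (turn j)) (pieces P (π ⟨$⟩ʳ j)))
    match i j j≡1+i = toℕ-injective (suc-injective (trans (proj₂ (proj₂ (turn i)))
      (trans (path-lookup path (cast len′ i) (cast len′ j)
                (trans (toℕ-cast len′ j) (trans j≡1+i (cong suc (sym (toℕ-cast len′ i))))))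
             (sym (proj₁ (proj₂ (turn j)))))))

-- Reasoning about commands

if-≡ : ∀ {A : Set} {i j} {x y : A} → i ≡ j → (if i ≡ᵇ j then x else y) ≡ x
if-≡ {i = i} refl rewrite ≡ᵇ-refl i = refl

if-≢ : ∀ {A : Set} {i j} {x y : A} → i ≢ j → (if i ≡ᵇ j then x else y) ≡ y
if-≢ i≢j rewrite ≢⇒≡ᵇ i≢j = refl

writes : Cmd → Name → Bool
writes (a ⟨ _ ⟩≔ _) b = toℕ b ≡ᵇ toℕ a
writes (get a)      b = toℕ b ≡ᵇ toℕ a
writes (c ▸ c′)     b = writes c b ∨ writes c′ b
writes (for e c)    b = writes c b

-- `writes` is Boolean, so that for a concrete command the side condition is proved by `refl`.
frame : ∀ c {b} → writes c b ≡ false → ∀ μ i → proj₁ (⟦ c ⟧ μ) b i ≡ proj₁ μ b i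
frame (a ⟨ e ⟩≔ e′) h μ i rewrite h = refl
frame (get a)       h μ i rewrite h = refl
frame (c ▸ c′) {b}  h μ i with writes c b in eq
... | false = trans (frame c′ h (⟦ c ⟧ μ) i) (frame c eq μ i)
frame (for e c) {b} h μ i = go (eval e (proj₁ μ)) μ
  where
  go : ∀ n μ → proj₁ (iter n ⟦ c ⟧ μ) b i ≡ proj₁ μ b i
  go zero    μ = refl
  go (suc n) μ = trans (go n (⟦ c ⟧ μ)) (frame c h μ i)

-- The invariant is indexed by the iterations left, as `iter` recurses on them. Where the iterations
-- done matter, it is instantiated with a number j such that j + k is the total.
loop-rule : ∀ c (I : ℕ → Mem → Set) (B : ℕ) →
  (∀ n μ → I (suc n) μ → I n (⟦ c ⟧ μ) × cost c μ ≤ B) →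
  ∀ n μ → I n μ → I 0 (iter n ⟦ c ⟧ μ) × loopCost (cost c) ⟦ c ⟧ n μ ≤ n * (B + 3)
loop-rule c I B body zero    μ inv = inv , z≤n
loop-rule c I B body (suc n) μ inv with body n μ inv
... | inv′ , c≤B with loop-rule c I B body n (⟦ c ⟧ μ) inv′
... | inv″ , t = inv″ , +-mono-≤ (+-monoˡ-≤ 3 c≤B) t

-- Multisets as tables of multiplicities

-- Larger kinds come first because `items` scans the kinds upwards and every `push` extends the list
-- at its head.
expand : (ℕ → ℕ) → ℕ → List ℕ
expand C zero    = []
expand C (suc n) = replicate (C n) n ++ expand C n

expand-cong : ∀ {C C′} n → (∀ z → z < n → C z ≡ C′ z) → expand C n ≡ expand C′ n
expand-cong zero    eq = refl
expand-cong (suc n) eq =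
  cong₂ (λ k zs → replicate k n ++ zs) (eq n ≤-refl) (expand-cong n (λ z z<n → eq z (m<n⇒m<1+n z<n)))

expand-length : ∀ {C k} n → (∀ z → C z ≤ k) → length (expand C n) ≤ n * k
expand-length             zero    C≤k = z≤n
expand-length {C} {k} (suc n) C≤k = ≤-trans
  (≤-reflexive (trans (length-++ (replicate (C n) n)) (cong (_+ length (expand C n)) (length-replicate (C n)))))
  (+-mono-≤ (C≤k n) (expand-length n C≤k))

without : (ℕ → ℕ) → ℕ → ℕ → ℕ
without C z w = if w ≡ᵇ z then 0 else C w

-- Isolates the copies of z, the only part that an update of the table at z changes.
expand-extract : ∀ C n {z} → z < n → expand C n ↭ replicate (C z) z ++ expand (without C z) n
expand-extract C (suc n) {z} z<1+n with z ≟ n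
... | yes refl = ++⁺ˡ (replicate (C n) n) (↭-reflexive (trans
      (expand-cong n (λ w w<n → sym (if-≢ {j = n} (<⇒≢ w<n))))
      (cong (λ k → replicate k n ++ expand (without C n) n) (sym (if-≡ {i = n} refl)))))
... | no z≢n = ↭-trans (++⁺ˡ (replicate (C n) n) (expand-extract C n (≤∧≢⇒< (≤-pred z<1+n) z≢n)))
      (↭-trans (swap-++ (replicate (C n) n) (replicate (C z) z))
        (++⁺ˡ (replicate (C z) z) (↭-reflexive
          (cong (λ k → replicate k n ++ expand (without C z) n) (sym (if-≢ (λ eq → z≢n (sym eq))))))))
  where
  swap-++ : ∀ (xs ys : List ℕ) {zs} → xs ++ (ys ++ zs) ↭ ys ++ (xs ++ zs)
  swap-++ []       ys = ↭-refl
  swap-++ (x ∷ xs) ys = ↭-trans (↭-prep x (swap-++ xs ys)) (↭-sym (shift x ys _))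

-- Sub-multisets of a list, given by the binary digits of a number; the
-- head of the list owns the most significant digit.

sel : List ℕ → ℕ → List ℕ
sel []       s = []
sel (z ∷ zs) s with 2 ^ length zs ≤? s
... | yes _ = z ∷ sel zs (s ∸ 2 ^ length zs)
... | no  _ = sel zs s

sel-take : ∀ z zs {s} → 2 ^ length zs ≤ s → sel (z ∷ zs) s ≡ z ∷ sel zs (s ∸ 2 ^ length zs)
sel-take z zs {s} h with 2 ^ length zs ≤? s
... | yes _  = refl
... | no ¬h = ⊥-elim (¬h h)

sel-skip : ∀ z zs {s} → s < 2 ^ length zs → sel (z ∷ zs) s ≡ sel zs s
sel-skip z zs {s} h with 2 ^ length zs ≤? s
... | yes h′ = ⊥-elim (<⇒≱ h h′)
... | no _   = refl

-- Binary digit i of s is 1 and belongs to an item of kind z, items being numbered from the end of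
-- the list. The constructors follow the comparisons made by the program, highest digit first.
data Pick : List ℕ → ℕ → ℕ → ℕ → Set where
  found : ∀ {z zs s} → 2 ^ length zs ≤ s → Pick (z ∷ zs) s z (length zs)
  take  : ∀ {w zs s z i} → 2 ^ length zs ≤ s → Pick zs (s ∸ 2 ^ length zs) z i → Pick (w ∷ zs) s z i
  skip  : ∀ {w zs s z i} → s < 2 ^ length zs → Pick zs s z i → Pick (w ∷ zs) s z i

digit-bound : ∀ m {s} → s < 2 ^ suc m → s ∸ 2 ^ m < 2 ^ m
digit-bound m {s} s<2^1+m = m<n+o⇒m∸n<o s (2 ^ m)
  (subst (s <_) (cong (2 ^ m +_) (+-identityʳ (2 ^ m))) s<2^1+m)
  where instance _ = >-nonZero (m^n>0 2 m)

pick-≤ : ∀ {zs s z i} → Pick zs s z i → 2 ^ i ≤ s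
pick-≤ (found h)   = h
pick-≤ (take {zs = zs} {s} h p) = ≤-trans (pick-≤ p) (m∸n≤m s (2 ^ length zs))
pick-≤ (skip h p) = pick-≤ p

-- Subtracting 2 ^ i clears a digit that is set, so nothing is borrowed and the other digits stay.
pick-sel : ∀ {zs s z i} → s < 2 ^ length zs → Pick zs s z i → sel zs s ↭ z ∷ sel zs (s ∸ 2 ^ i)
pick-sel {z ∷ zs} {s} s< (found h) = ↭-reflexive (trans (sel-take z zs h)
  (cong (z ∷_) (sym (sel-skip z zs (digit-bound (length zs) s<)))))
pick-sel {w ∷ zs} {s} {z} {i} s< (take h p) = ↭-trans (↭-reflexive (sel-take w zs h))
  (↭-trans (↭-prep w (pick-sel (digit-bound (length zs) s<) p))
  (↭-trans (↭-swap w z ↭-refl) (↭-prep z (↭-reflexive (sym (trans (sel-take w zs h′)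
    (cong (λ r → w ∷ sel zs r) commute)))))))
  where
  -- The lower digits alone amount to at least 2 ^ i, so the top digit survives the subtraction.
  h′ : 2 ^ length zs ≤ s ∸ 2 ^ i
  h′ = subst (_≤ s ∸ 2 ^ i) (m∸[m∸n]≡n h) (∸-monoʳ-≤ s (pick-≤ p))
  commute : s ∸ 2 ^ i ∸ 2 ^ length zs ≡ s ∸ 2 ^ length zs ∸ 2 ^ i
  commute = trans (∸-+-assoc s (2 ^ i) (2 ^ length zs)) (trans (cong (s ∸_) (+-comm (2 ^ i) (2 ^ length zs)))
              (sym (∸-+-assoc s (2 ^ length zs) (2 ^ i))))
pick-sel {w ∷ zs} {s} {i = i} s< (skip h p) = ↭-trans (↭-reflexive (sel-skip w zs h))
  (↭-trans (pick-sel h p) (↭-prep _ (↭-reflexive (sym (sel-skip w zs (≤-<-trans (m∸n≤m s (2 ^ i)) h))))))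

sel-pick : ∀ zs {s z} → z ∈ sel zs s → ∃[ i ] Pick zs s z i
sel-pick (w ∷ zs) {s} z∈ with 2 ^ length zs ≤? s
sel-pick (w ∷ zs) (here refl) | yes h = _ , found h
sel-pick (w ∷ zs) (there z∈) | yes h with sel-pick zs z∈
... | i , p = i , take h p
sel-pick (w ∷ zs) z∈ | no h with sel-pick zs z∈
... | i , p = i , skip (≰⇒> h) p

sel-full : ∀ zs → sel zs (2 ^ length zs ∸ 1) ≡ zs
sel-full []       = refl
sel-full (z ∷ zs) = trans (sel-take z zs (subst (2 ^ length zs ≤_) (sym split) (m≤m+n _ _)))
  (cong (z ∷_) (trans (cong (sel zs) (trans (cong (_∸ 2 ^ length zs) split) (m+n∸m≡n (2 ^ length zs) _)))
                      (sel-full zs)))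
  where
  split : 2 ^ suc (length zs) ∸ 1 ≡ 2 ^ length zs + (2 ^ length zs ∸ 1)
  split = trans (cong (λ n → 2 ^ length zs + n ∸ 1) (+-identityʳ _)) (+-∸-assoc (2 ^ length zs) (m^n>0 2 (length zs)))

sel-zero : ∀ zs → sel zs 0 ≡ []
sel-zero []       = refl
sel-zero (z ∷ zs) = trans (sel-skip z zs (m^n>0 2 (length zs))) (sel-zero zs)

sel-nonempty : ∀ zs {s} → 0 < s → s < 2 ^ length zs → sel zs s ≢ []
sel-nonempty []       0<s (s≤s z≤n) eq with 0<s
... | ()
sel-nonempty (z ∷ zs) {s} 0<s s< eq with 2 ^ length zs ≤? s
sel-nonempty (z ∷ zs) 0<s s< () | yes h
... | no h = sel-nonempty zs 0<s (≰⇒> h) eq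

-- The program

numPieces numColours counter triangle numPairs colR colT colL colB pair₁ pair₂ kindNo : Name
count rightOf topOf leftOf bottomOf itemKind weight numItems step numSubsets : Name
ways slot subset rest item smaller : Name
numPieces  = # 0
numColours = # 1
counter    = # 2
triangle   = # 3
numPairs   = # 4
colR       = # 5
colT       = # 6
colL       = # 7
colB       = # 8
pair₁      = # 9
pair₂      = # 10
kindNo     = # 11
count      = # 12
rightOf    = # 13
topOf      = # 14
leftOf     = # 15
bottomOf   = # 16
itemKind   = # 17
weight     = # 18
numItems   = # 19
step       = # 20
numSubsets = # 21
ways       = # 22
slot       = # 23
subset     = # 24
rest       = # 25
item       = # 26
smaller    = # 27

extendTriangle : Cmd
extendTriangle =
  triangle ⟨ var counter ⊕ con 1 ⟩≔ triangle ! var counter ⊕ (var counter ⊕ con 1)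
  ▸ counter ≔ var counter ⊕ con 1

-- The first loop reaches `tri (suc K)`, which bounds the codes of colour pairs. These codes are
-- paired in turn, so the second loop continues the table beyond that index; its entry there bounds
-- the kinds.
tables : Cmd
tables =
  get numPieces ▸ get numColours
  ▸ for (var numColours ⊕ con 1) extendTriangle
  ▸ numPairs ≔ triangle ! var counter
  ▸ for (var numPairs) extendTriangle

-- Maximum and minimum by truncated subtraction.
pairExp : Exp → Exp → Exp
pairExp e e′ = triangle ! (e ⊕ (e′ ⊖ e)) ⊕ (e ⊖ (e ⊖ e′))

scan classify enter readPiece : Cmd
scan      = get colR ▸ get colT ▸ get colL ▸ get colB
classify  =
  pair₁ ≔ pairExp (var colR) (var colL)
  ▸ pair₂ ≔ pairExp (var colT) (var colB)
  ▸ kindNo ≔ pairExp (var pair₁) (var pair₂)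
enter     =
  count ⟨ var kindNo ⟩≔ (count ! var kindNo ⊕ con 1)
                        ⊖ ((count ! var kindNo ⊖ con 3) ⊕ (count ! var kindNo ⊖ con 3))
  -- Any piece of the kind can represent it, so the latest one overwrites its predecessors.
  ▸ rightOf ⟨ var kindNo ⟩≔ var colR
  ▸ topOf ⟨ var kindNo ⟩≔ var colT
  ▸ leftOf ⟨ var kindNo ⟩≔ var colL
  ▸ bottomOf ⟨ var kindNo ⟩≔ var colB
readPiece = scan ▸ classify ▸ enter

-- One more, except that 5 becomes 3: two out of five pieces of a kind can be
-- dropped, so parities and a cap of 4 are all that matters.
capped : ℕ → ℕ
capped n = n + 1 ∸ ((n ∸ 3) + (n ∸ 3))

-- Item i has weight 2 ^ i times K + 1, the distance of table rows; removing an item from a subset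
-- is then one subtraction of addresses.
push items : Cmd
push =
  itemKind ⟨ var numItems ⟩≔ var kindNo
  ▸ weight ⟨ var numItems ⟩≔ var step
  ▸ numItems ≔ var numItems ⊕ con 1
  ▸ step ≔ var step ⊕ var step
  ▸ numSubsets ≔ var numSubsets ⊕ var numSubsets
items =
  step ≔ var numColours ⊕ con 1
  ▸ numSubsets ≔ con 1
  ▸ kindNo ≔ con 0
  ▸ for (triangle ! var numPairs) (for (count ! var kindNo) push ▸ kindNo ≔ var kindNo ⊕ con 1)

-- Row s of `ways` (K + 1 cells) describes the sub-multiset s of the items:
-- cell c counts the ways of lining it up with colour c leftmost, and cell
-- 0 is positive if it can be lined up at all.
base : Cmd
base = for (var numColours ⊕ con 1) (ways ⟨ var slot ⟩≔ con 1 ▸ slot ≔ var slot ⊕ con 1)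

-- Addition plays the part of disjunction, as only positivity of the cells is used.
bump : Exp → Exp → Cmd
bump e e′ = ways ⟨ e ⟩≔ ways ! e ⊕ ways ! e′

-- The item goes to the left of a row of `smaller`: side b meets the old leftmost colour, side a
-- becomes the new one. The second `bump` records the success in cell 0.
prepend : Name → Name → Cmd
prepend a b =
  bump (var subset ⊕ a ! var kindNo) (var smaller ⊕ b ! var kindNo)
  ▸ bump (var subset) (var smaller ⊕ b ! var kindNo)

lookupItem prependAll useItem : Cmd
lookupItem =
  rest ≔ var rest ⊖ weight ! var item
  ▸ smaller ≔ var subset ⊖ weight ! var item
  ▸ kindNo ≔ itemKind ! var item
prependAll = prepend leftOf rightOf ▸ prepend topOf bottomOf ▸ prepend rightOf leftOf ▸ prepend bottomOf topOf
useItem = lookupItem ▸ prependAll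

tryWith nextWith : Cmd → Cmd
tryWith use =
  item ≔ var item ⊖ con 1
  -- The count is 1 if the weight is at most `rest`, that is if the digit is set, and 0 otherwise.
  ▸ for (con 1 ⊖ (weight ! var item ⊖ var rest)) use
nextWith try =
  subset ≔ var subset ⊕ (var numColours ⊕ con 1)
  ▸ rest ≔ var subset
  ▸ item ≔ var numItems
  ▸ for (var numItems) try

search : Cmd
search = for (var numSubsets ⊖ con 1) (nextWith (tryWith useItem))

matcher : Cmd
matcher = tables ▸ for (var numPieces) readPiece ▸ items ▸ base ▸ search

-- At the end `subset` is the offset of the row of all items, and hence the address of its cell 0.
answer : Exp
answer = ways ! var subset

-- Building the tables

m+[n∸m]≡m⊔n : ∀ m n → m + (n ∸ m) ≡ m ⊔ n
m+[n∸m]≡m⊔n m n with ≤-total m n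
... | inj₁ m≤n = trans (m+[n∸m]≡n m≤n) (sym (m≤n⇒m⊔n≡n m≤n))
... | inj₂ n≤m = trans (cong (m +_) (m≤n⇒m∸n≡0 n≤m)) (trans (+-identityʳ m) (sym (m≥n⇒m⊔n≡m n≤m)))

m∸[m∸n]≡m⊓n : ∀ m n → m ∸ (m ∸ n) ≡ m ⊓ n
m∸[m∸n]≡m⊓n m n with ≤-total m n
... | inj₁ m≤n = trans (cong (m ∸_) (m≤n⇒m∸n≡0 m≤n)) (sym (m≤n⇒m⊓n≡m m≤n))
... | inj₂ n≤m = trans (m∸[m∸n]≡n n≤m) (sym (m≥n⇒m⊓n≡n n≤m))

Triangle : ℕ → Store → Set
Triangle n σ = ∀ i → i ≤ n → σ triangle i ≡ tri i

triangle-step : ∀ j σ xs → σ counter 0 ≡ j → Triangle j σ →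
  let σ′ = proj₁ (⟦ extendTriangle ⟧ (σ , xs)) in σ′ counter 0 ≡ suc j × Triangle (suc j) σ′
triangle-step j σ xs refl tr = +-comm (σ counter 0) 1 , new
  where
  new : Triangle (suc (σ counter 0)) (proj₁ (⟦ extendTriangle ⟧ (σ , xs)))
  new i i≤1+j with i ≟ σ counter 0 + 1
  ... | yes refl = trans (if-≡ {i = i} refl) (trans (cong₂ _+_ (tr _ ≤-refl) (+-comm _ 1))
                     (trans (+-comm (tri (σ counter 0)) _) (cong tri (+-comm 1 (σ counter 0)))))
  ... | no i≢ = trans (if-≢ i≢) (tr i (≤-pred (≤∧≢⇒< i≤1+j (λ eq → i≢ (trans eq (+-comm 1 _))))))

triangle-loop : ∀ n j σ xs → σ counter 0 ≡ j → Triangle j σ →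
  let μ′ = iter n ⟦ extendTriangle ⟧ (σ , xs) in
  (proj₁ μ′ counter 0 ≡ j + n × Triangle (j + n) (proj₁ μ′) × proj₂ μ′ ≡ xs)
  × loopCost (cost extendTriangle) ⟦ extendTriangle ⟧ n (σ , xs) ≤ n * (cost extendTriangle (start []) + 3)
triangle-loop n j σ xs eq tr with loop-rule extendTriangle I _ body n (σ , xs) (j , refl , eq , tr , refl)
  where
  I : ℕ → Mem → Set
  I k (σ , ys) = ∃[ i ] i + k ≡ j + n × σ counter 0 ≡ i × Triangle i σ × ys ≡ xs
  body : ∀ k μ → I (suc k) μ → I k (⟦ extendTriangle ⟧ μ) × cost extendTriangle μ ≤ cost extendTriangle (start [])
  body k (σ , ys) (i , i+k , eq , tr , eq′) with triangle-step i σ ys eq tr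
  ... | eq″ , tr′ = (suc i , trans (sym (+-suc i k)) i+k , eq″ , tr′ , eq′) , ≤-refl
... | (i , i+0 , eq′ , tr′ , eq″) , t with trans (sym (+-identityʳ i)) i+0
... | refl = (eq′ , tr′ , eq″) , t

-- All costs are compared with multiples of one number G ≥ 1.
record Within (G : ℕ) (c : Cmd) (a : ℕ) (μ : Mem) : Set where
  constructor within
  field
    bound : cost c μ ≤ a * G

within-const : ∀ {G} c a μ → 1 ≤ G → cost c μ ≤ a → Within G c a μ
within-const {G} c a μ 1≤G t≤a = within (≤-trans t≤a (m≤m*n a G))
  where instance _ = >-nonZero 1≤G

within-▸ : ∀ {G c c′ a b μ} → Within G c a μ → Within G c′ b (⟦ c ⟧ μ) → Within G (c ▸ c′) (a + b) μ
within-▸ {G} {a = a} {b} (within t≤) (within u≤) =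
  within (≤-trans (+-mono-≤ t≤ u≤) (≤-reflexive (sym (*-distribʳ-+ G a b))))

within-for : ∀ {G} e c b μ → 1 ≤ G →
  loopCost (cost c) ⟦ c ⟧ (eval e (proj₁ μ)) μ ≤ b * G →
  Within G (for e c) (expCost e + 4 + (b + 1)) μ
within-for {G} e c b μ 1≤G l≤ = within (≤-trans
  (+-mono-≤ (m≤m*n (expCost e + 4) G) (+-mono-≤ l≤ (m≤m*n 1 G)))
  (≤-reflexive (sym (trans (*-distribʳ-+ G (expCost e + 4) (b + 1))
                           (cong ((expCost e + 4) * G +_) (*-distribʳ-+ G b 1))))))
  where instance _ = >-nonZero 1≤G

*-bound : ∀ {l n G} b → l ≤ n * b → n ≤ G → l ≤ b * G
*-bound {G = G} b l≤ n≤G = ≤-trans l≤ (≤-trans (*-monoˡ-≤ b n≤G) (≤-reflexive (*-comm G b)))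

triangleCost tablesCost : ℕ
triangleCost = cost extendTriangle (start []) + 3
tablesCost = 1 + (1 + (expCost (var numColours ⊕ con 1) + 4 + (triangleCost + 1)
  + (cost (numPairs ≔ triangle ! var counter) (start []) + (expCost (var numPairs) + 4 + (triangleCost + 1)))))

record Tables (M K : ℕ) (xs : List ℕ) (μ : Mem) : Set where
  field
    pieces≡   : proj₁ μ numPieces 0 ≡ M
    colours≡  : proj₁ μ numColours 0 ≡ K
    pairs≡    : proj₁ μ numPairs 0 ≡ tri (suc K)
    triangle≡ : Triangle (tri (suc K)) (proj₁ μ)
    input≡    : proj₂ μ ≡ xs

tables-correct : ∀ M K xs {G} → 1 ≤ G → suc K ≤ G → tri (suc K) ≤ G →
  Tables M K xs (⟦ tables ⟧ (start (M ∷ K ∷ xs)))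
  × Within G tables tablesCost (start (M ∷ K ∷ xs))
tables-correct M K xs {G} 1≤G K<G N≤G = record
  { pieces≡   = frame (extend₁ ▸ compute ▸ extend₂) refl μ₀ 0
  ; colours≡  = frame (extend₁ ▸ compute ▸ extend₂) refl μ₀ 0
  ; pairs≡    = trans (frame extend₂ refl μ₂ 0) N≡
  ; triangle≡ = λ i i≤N → tr₂ i (≤-trans i≤N (≤-trans (≤-reflexive (sym N≡)) (m≤n+m _ _)))
  ; input≡    = trans in₂ in₁
  }
  , within-▸ (within-const (get numPieces) 1 (start (M ∷ K ∷ xs)) 1≤G ≤-refl)
   (within-▸ (within-const (get numColours) 1 _ 1≤G ≤-refl)
   (within-▸ (within-for (var numColours ⊕ con 1) extendTriangle triangleCost μ₀ 1≤G
                (*-bound triangleCost t₁ (≤-trans (≤-reflexive (+-comm K 1)) K<G)))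
   (within-▸ (within-const compute (cost compute (start [])) μ₁ 1≤G ≤-refl)
             (within-for (var numPairs) extendTriangle triangleCost μ₂ 1≤G
                (*-bound triangleCost t₂ (≤-trans (≤-reflexive N≡) N≤G))))))
  where
  extend₁ compute extend₂ : Cmd
  extend₁ = for (var numColours ⊕ con 1) extendTriangle
  compute = numPairs ≔ triangle ! var counter
  extend₂ = for (var numPairs) extendTriangle
  μ₀ μ₁ μ₂ : Mem
  μ₀ = ⟦ get numPieces ▸ get numColours ⟧ (start (M ∷ K ∷ xs))
  μ₁ = ⟦ extend₁ ⟧ μ₀
  μ₂ = ⟦ compute ⟧ μ₁
  phase₁ = triangle-loop (K + 1) 0 (proj₁ μ₀) xs refl (λ { zero _ → refl })
  t₁ = proj₂ phase₁
  in₁ = proj₂ (proj₂ (proj₁ phase₁))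
  N≡ : proj₁ μ₂ numPairs 0 ≡ tri (suc K)
  N≡ = trans (cong (proj₁ μ₁ triangle) (proj₁ (proj₁ phase₁)))
         (trans (proj₁ (proj₂ (proj₁ phase₁)) (K + 1) ≤-refl) (cong tri (+-comm K 1)))
  phase₂ = triangle-loop (proj₁ μ₂ numPairs 0) (K + 1) (proj₁ μ₂) (proj₂ μ₂) (proj₁ (proj₁ phase₁))
             (proj₁ (proj₂ (proj₁ phase₁)))
  t₂ = proj₂ phase₂
  tr₂ = proj₁ (proj₂ (proj₁ phase₂))
  in₂ = proj₂ (proj₂ (proj₁ phase₂))

-- Reading the pieces

pairExp-correct : ∀ e e′ {σ n} → Triangle n σ → eval e σ ≤ n → eval e′ σ ≤ n →
                  eval (pairExp e e′) σ ≡ pair (eval e σ) (eval e′ σ)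
pairExp-correct e e′ {σ} {n} tr e≤n e′≤n = cong₂ _+_
  (trans (cong (σ triangle) (m+[n∸m]≡m⊔n (eval e σ) (eval e′ σ))) (tr _ (⊔-lub e≤n e′≤n)))
  (m∸[m∸n]≡m⊓n (eval e σ) (eval e′ σ))

classify-correct : ∀ {σ xs K} → Triangle (tri (suc K)) σ →
  σ colR 0 ≤ K → σ colT 0 ≤ K → σ colL 0 ≤ K → σ colB 0 ≤ K →
  proj₁ (⟦ classify ⟧ (σ , xs)) kindNo 0 ≡ kindOf (σ colR 0) (σ colT 0) (σ colL 0) (σ colB 0)
classify-correct {σ} {xs} {K} tr r≤ t≤ l≤ b≤ =
  trans (pairExp-correct (var pair₁) (var pair₂) {σ″} {tri (suc K)} tr
          (≤-trans (≤-reflexive p≡) (<⇒≤ (pair-bound (s≤s r≤) (s≤s l≤))))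
          (≤-trans (≤-reflexive q≡) (<⇒≤ (pair-bound (s≤s t≤) (s≤s b≤)))))
        (cong₂ pair p≡ q≡)
  where
  K≤ : K ≤ tri (suc K)
  K≤ = ≤-trans (n≤1+n K) (m≤m+n (suc K) (tri K))
  σ′ σ″ : Store
  σ′ = proj₁ (⟦ pair₁ ≔ pairExp (var colR) (var colL) ⟧ (σ , xs))
  σ″ = proj₁ (⟦ pair₂ ≔ pairExp (var colT) (var colB) ⟧ (σ′ , xs))
  p≡ : eval (pairExp (var colR) (var colL)) σ ≡ pair (σ colR 0) (σ colL 0)
  p≡ = pairExp-correct (var colR) (var colL) {σ} tr (≤-trans r≤ K≤) (≤-trans l≤ K≤)
  q≡ : eval (pairExp (var colT) (var colB)) σ ≡ pair (σ colT 0) (σ colB 0)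
  q≡ = pairExp-correct (var colT) (var colB) {σ} tr (≤-trans t≤ K≤) (≤-trans b≤ K≤)

-- Colours must be positive because cell 0 of each row of `ways` has a meaning of its own.
record KnownKind (K z r t l b : ℕ) : Set where
  field
    kind≡   : z ≡ kindOf r t l b
    right∈  : 1 ≤ r × r ≤ K
    top∈    : 1 ≤ t × t ≤ K
    left∈   : 1 ≤ l × l ≤ K
    bottom∈ : 1 ≤ b × b ≤ K

Known : ℕ → Store → ℕ → Set
Known K σ z = KnownKind K z (σ rightOf z) (σ topOf z) (σ leftOf z) (σ bottomOf z)

record Tally (K : ℕ) (σ : Store) : Set where
  field
    triangle≡ : Triangle (tri (suc K)) σ
    count≤4   : ∀ z → σ count z ≤ 4
    known     : ∀ z → 0 < σ count z → Known K σ z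

capped≤4 : ∀ {n} → n ≤ 4 → capped n ≤ 4
capped≤4 {0} _ = s≤s z≤n
capped≤4 {1} _ = s≤s (s≤s z≤n)
capped≤4 {2} _ = s≤s (s≤s (s≤s z≤n))
capped≤4 {3} _ = s≤s (s≤s (s≤s (s≤s z≤n)))
capped≤4 {4} _ = s≤s (s≤s (s≤s z≤n))
capped≤4 {suc (suc (suc (suc (suc _))))} (s≤s (s≤s (s≤s (s≤s ()))))

-- Equivalence of lists under the cap

infix 3 _⇌_
_⇌_ : List ℕ → List ℕ → Set
xs ⇌ ys = (Row xs → Row ys) × (Row ys → Row xs)

↭⇒⇌ : ∀ {xs ys} → xs ↭ ys → xs ⇌ ys
↭⇒⇌ p = row-resp-↭ p , row-resp-↭ (↭-sym p)

⇌-trans : ∀ {xs ys zs} → xs ⇌ ys → ys ⇌ zs → xs ⇌ zs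
⇌-trans (f , g) (f′ , g′) = (λ r → f′ (f r)) , (λ r → g (g′ r))

-- Only n = 4 needs an argument: the fifth copy leaves three. In the other cases both lists are the
-- same.
capped-row : ∀ {z} r t l b → z ≡ kindOf r t l b → ∀ n E → n ≤ 4 →
             z ∷ (replicate n z ++ E) ⇌ replicate (capped n) z ++ E
capped-row r t l b eq 0 E _ = ↭⇒⇌ ↭-refl
capped-row r t l b eq 1 E _ = ↭⇒⇌ ↭-refl
capped-row r t l b eq 2 E _ = ↭⇒⇌ ↭-refl
capped-row r t l b eq 3 E _ = ↭⇒⇌ ↭-refl
capped-row r t l b eq 4 E _ = row-drop-two r t l b eq , row-add-two
capped-row r t l b eq (suc (suc (suc (suc (suc _))))) E (s≤s (s≤s (s≤s (s≤s ()))))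

-- The context E of `capped-row` has to hold the other kinds of the table together with the unread
-- pieces ks, because a row mixes them all.
enter-row : ∀ {z n} r t l b → z ≡ kindOf r t l b → z < n → ∀ C → C z ≤ 4 → ∀ ks →
  expand (λ w → if w ≡ᵇ z then capped (C z) else C w) n ++ ks ⇌ expand C n ++ z ∷ ks
enter-row {z} {n} r t l b eq z<n C C≤4 ks =
  ⇌-trans (↭⇒⇌ extract′)
    (⇌-trans (let f , g = capped-row r t l b eq (C z) (expand (without C z) n ++ ks) C≤4 in g , f)
      (↭⇒⇌ (↭-sym (↭-trans (shift z (expand C n) ks) (↭-prep z extract)))))
  where
  C′ : ℕ → ℕ
  C′ w = if w ≡ᵇ z then capped (C z) else C w
  same : ∀ w → without C′ z w ≡ without C z w
  same w with w ≡ᵇ z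
  ... | true  = refl
  ... | false = refl
  extract : expand C n ++ ks ↭ replicate (C z) z ++ expand (without C z) n ++ ks
  extract = ↭-trans (++⁺ʳ ks (expand-extract C n z<n))
    (↭-reflexive (++-assoc (replicate (C z) z) (expand (without C z) n) ks))
  extract′ : expand C′ n ++ ks ↭ replicate (capped (C z)) z ++ expand (without C z) n ++ ks
  extract′ = ↭-trans (++⁺ʳ ks (expand-extract C′ n z<n))
    (↭-reflexive (trans (cong₂ (λ k E → (replicate k z ++ E) ++ ks) (if-≡ {i = z} refl)
                          (expand-cong n (λ w _ → same w)))
                        (++-assoc (replicate (capped (C z)) z) (expand (without C z) n) ks)))

enter-tally : ∀ {K σ xs} → Tally K σ →
  let τ = proj₁ (⟦ enter ⟧ (σ , xs)) in
  KnownKind K (σ kindNo 0) (σ colR 0) (σ colT 0) (σ colL 0) (σ colB 0) → Tally K τ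
enter-tally {K} {σ} {xs} tally new = record
  { triangle≡ = Tally.triangle≡ tally ; count≤4 = count≤ ; known = knowns }
  where
  τ : Store
  τ = proj₁ (⟦ enter ⟧ (σ , xs))
  count≤ : ∀ w → τ count w ≤ 4
  count≤ w with w ≡ᵇ σ kindNo 0
  ... | true  = capped≤4 (Tally.count≤4 tally (σ kindNo 0))
  ... | false = Tally.count≤4 tally w
  knowns : ∀ w → 0 < τ count w → Known K τ w
  knowns w 0<c with w ≟ σ kindNo 0
  ... | yes refl rewrite ≡ᵇ-refl (σ kindNo 0) = new
  ... | no w≢ rewrite ≢⇒≡ᵇ w≢ = Tally.known tally w 0<c

readCost : ℕ
readCost = cost readPiece (start [])

module Reading {K : ℕ} (P : Puzzle K) where

  kindAt : Fin (size P) → ℕ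
  kindAt i = pieceKind (pieces P i)

  -- The loop invariant: the capped table together with the unread pieces can be lined up exactly if
  -- the whole puzzle can.
  Reads : ℕ → Mem → Set
  Reads n (σ , xs) = ∃[ is ] length is ≡ n × xs ≡ concatMap (λ i → encodePiece (pieces P i)) is
    × Tally K σ × (expand (σ count) (tri (tri (suc K))) ++ map kindAt is ⇌ kinds P)

  readPiece-correct : ∀ n μ → Reads (suc n) μ → Reads n (⟦ readPiece ⟧ μ) × cost readPiece μ ≤ readCost
  readPiece-correct n (σ , _) (i ∷ is , len , refl , tally , row) =
    (is , suc-injective len , refl , tally′ , ⇌-trans row′ row) , ≤-refl
    where
    p : Piece K
    p = pieces P i
    xs : List ℕ
    xs = concatMap (λ i → encodePiece (pieces P i)) is
    in-range : (c : Fin K) → 1 ≤ colour c × colour c ≤ K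
    in-range c = s≤s z≤n , toℕ<n c
    σ₁ σ₂ : Store
    σ₁ = proj₁ (⟦ scan ⟧ (σ , concatMap (λ i → encodePiece (pieces P i)) (i ∷ is)))
    σ₂ = proj₁ (⟦ classify ⟧ (σ₁ , xs))
    z≡ : σ₂ kindNo 0 ≡ pieceKind p
    z≡ = classify-correct {σ₁} {xs} {K} (Tally.triangle≡ tally)
           (toℕ<n (right p)) (toℕ<n (top p)) (toℕ<n (left p)) (toℕ<n (bottom p))
    tally₂ : Tally K σ₂
    tally₂ = record { triangle≡ = Tally.triangle≡ tally ; count≤4 = Tally.count≤4 tally
                    ; known = Tally.known tally }
    tally′ : Tally K (proj₁ (⟦ enter ⟧ (σ₂ , xs)))
    tally′ = enter-tally {K} {σ₂} {xs} tally₂ record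
      { kind≡ = z≡ ; right∈ = in-range (right p) ; top∈ = in-range (top p)
      ; left∈ = in-range (left p) ; bottom∈ = in-range (bottom p) }
    row′ : expand (proj₁ (⟦ enter ⟧ (σ₂ , xs)) count) (tri (tri (suc K))) ++ map kindAt is
         ⇌ expand (σ count) (tri (tri (suc K))) ++ map kindAt (i ∷ is)
    row′ = subst (λ z → expand (proj₁ (⟦ enter ⟧ (σ₂ , xs)) count) (tri (tri (suc K))) ++ map kindAt is
                      ⇌ expand (σ count) (tri (tri (suc K))) ++ z ∷ map kindAt is) z≡
      (enter-row (colour (right p)) (colour (top p)) (colour (left p)) (colour (bottom p)) z≡
        (≤-trans (s≤s (≤-reflexive z≡))
          (pair-bound (pair-bound (s≤s (toℕ<n (right p))) (s≤s (toℕ<n (left p))))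
                      (pair-bound (s≤s (toℕ<n (top p))) (s≤s (toℕ<n (bottom p))))))
        (σ count) (Tally.count≤4 tally _) (map kindAt is))

-- Listing the items

-- The index of an item is the length of the tail behind it, which is also its digit position in
-- `sel`.
Stored : ℕ → List ℕ → Store → Set
Stored W []       σ = ⊤
Stored W (z ∷ zs) σ = σ itemKind (length zs) ≡ z × σ weight (length zs) ≡ 2 ^ length zs * W × Stored W zs σ

stored-cong : ∀ {W σ τ} zs → (∀ i → i < length zs → τ itemKind i ≡ σ itemKind i) →
              (∀ i → i < length zs → τ weight i ≡ σ weight i) → Stored W zs σ → Stored W zs τ
stored-cong []       kind≡ weight≡ _ = tt
stored-cong (z ∷ zs) kind≡ weight≡ (k , w , s) =
  trans (kind≡ _ ≤-refl) k , trans (weight≡ _ ≤-refl) w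
  , stored-cong zs (λ i i< → kind≡ i (m<n⇒m<1+n i<)) (λ i i< → weight≡ i (m<n⇒m<1+n i<)) s

record Listed (W : ℕ) (zs : List ℕ) (σ : Store) : Set where
  field
    items≡   : σ numItems 0 ≡ length zs
    subsets≡ : σ numSubsets 0 ≡ 2 ^ length zs
    step≡    : σ step 0 ≡ 2 ^ length zs * W
    stored   : Stored W zs σ

double-power : ∀ n {x} → x ≡ 2 ^ n → x + x ≡ 2 ^ suc n
double-power n refl = cong (2 ^ n +_) (sym (+-identityʳ (2 ^ n)))

push-correct : ∀ {W} z zs σ xs → σ kindNo 0 ≡ z → Listed W zs σ → Listed W (z ∷ zs) (proj₁ (⟦ push ⟧ (σ , xs)))
push-correct {W} z zs σ xs refl inv = record
  { items≡   = trans (+-comm _ 1) (cong suc items≡)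
  ; subsets≡ = double-power (length zs) subsets≡
  ; step≡    = trans (cong₂ _+_ step≡ step≡) (trans (sym (*-distribʳ-+ W (2 ^ length zs) (2 ^ length zs)))
                 (cong (_* W) (double-power (length zs) refl)))
  ; stored   = if-≡ (sym items≡) , trans (if-≡ (sym items≡)) step≡
             , stored-cong {σ = σ} zs (λ i i< → if-≢ (λ eq → <⇒≢ i< (trans eq items≡)))
                           (λ i i< → if-≢ (λ eq → <⇒≢ i< (trans eq items≡))) stored
  }
  where open Listed inv

pushCost listCost itemsCost : ℕ
pushCost = cost push (start []) + 3
-- The factor 4 is the cap on the multiplicity of a kind.
listCost = expCost (count ! var kindNo) + 4 + (4 * pushCost + 1) + cost (kindNo ≔ var kindNo ⊕ con 1) (start [])
itemsCost = cost (step ≔ var numColours ⊕ con 1) (start []) + (cost (numSubsets ≔ con 1) (start [])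
  + (cost (kindNo ≔ con 0) (start []) + (expCost (triangle ! var numPairs) + 4 + (listCost + 3 + 1))))

push-loop : ∀ {W} n z zs σ xs → σ kindNo 0 ≡ z → Listed W zs σ →
  Listed W (replicate n z ++ zs) (proj₁ (iter n ⟦ push ⟧ (σ , xs)))
  × loopCost (cost push) ⟦ push ⟧ n (σ , xs) ≤ n * pushCost
push-loop {W} n z zs σ xs z≡ inv with loop-rule push I (cost push (start [])) body n (σ , xs) (0 , refl , z≡ , inv)
  where
  I : ℕ → Mem → Set
  I k (σ , _) = ∃[ j ] j + k ≡ n × σ kindNo 0 ≡ z × Listed W (replicate j z ++ zs) σ
  body : ∀ k μ → I (suc k) μ → I k (⟦ push ⟧ μ) × cost push μ ≤ cost push (start [])
  body k (σ , xs) (j , j+k , z≡ , inv) =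
    (suc j , trans (sym (+-suc j k)) j+k , z≡ , push-correct z (replicate j z ++ zs) σ xs z≡ inv) , ≤-refl
... | (j , j+0 , _ , inv′) , t with trans (sym (+-identityʳ j)) j+0
... | refl = inv′ , t

listKind : Cmd
listKind = for (count ! var kindNo) push ▸ kindNo ≔ var kindNo ⊕ con 1

list-loop : ∀ {W C} n σ xs → (∀ z → C z ≤ 4) → (∀ z → σ count z ≡ C z) → σ kindNo 0 ≡ 0 → Listed W [] σ →
  Listed W (expand C n) (proj₁ (iter n ⟦ listKind ⟧ (σ , xs)))
  × loopCost (cost listKind) ⟦ listKind ⟧ n (σ , xs) ≤ n * (listCost + 3)
list-loop {W} {C} n σ xs C≤4 C≡ z≡ inv with loop-rule listKind I listCost body n (σ , xs) (0 , refl , C≡ , z≡ , inv)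
  where
  I : ℕ → Mem → Set
  I k (σ , _) = ∃[ z ] z + k ≡ n × (∀ w → σ count w ≡ C w) × σ kindNo 0 ≡ z × Listed W (expand C z) σ
  body : ∀ k μ → I (suc k) μ → I k (⟦ listKind ⟧ μ) × cost listKind μ ≤ listCost
  body k μ@(σ , xs) (z , z+k , C≡ , refl , inv)
    with push-loop (σ count z) z (expand C z) σ xs refl inv
  ... | inv′ , t =
    ( suc z , trans (sym (+-suc z k)) z+k
    , (λ w → trans (frame listKind refl μ w) (C≡ w))
    , trans (cong (_+ 1) (frame (for (count ! var kindNo) push) refl μ 0)) (+-comm z 1)
    , listed)
    , +-monoˡ-≤ _ (+-monoʳ-≤ (expCost (count ! var kindNo) + 4) (+-monoˡ-≤ 1
        (≤-trans t (*-monoˡ-≤ pushCost (≤-trans (≤-reflexive (C≡ z)) (C≤4 z))))))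
    where
    zs = replicate (σ count z) z ++ expand C z
    listed : Listed W (replicate (C z) z ++ expand C z) (proj₁ (⟦ listKind ⟧ μ))
    listed = subst (λ k → Listed W (replicate k z ++ expand C z) (proj₁ (⟦ listKind ⟧ μ))) (C≡ z) record
      { items≡ = Listed.items≡ inv′ ; subsets≡ = Listed.subsets≡ inv′ ; step≡ = Listed.step≡ inv′
      ; stored = stored-cong zs (λ _ _ → refl) (λ _ _ → refl) (Listed.stored inv′) }
... | (z , z+0 , _ , _ , inv′) , t with trans (sym (+-identityʳ z)) z+0
... | refl = inv′ , t

items-correct : ∀ {K} σ xs {G} → 1 ≤ G → tri (tri (suc K)) ≤ G →
  σ numColours 0 ≡ K → σ numPairs 0 ≡ tri (suc K) → σ numItems 0 ≡ 0 → Tally K σ →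
  Listed (suc K) (expand (σ count) (tri (tri (suc K)))) (proj₁ (⟦ items ⟧ (σ , xs)))
  × Within G items itemsCost (σ , xs)
items-correct {K} σ xs {G} 1≤G n≤G K≡ N≡ m≡ tally with list-loop {suc K} (σ triangle (σ numPairs 0)) σ′ xs
    (Tally.count≤4 tally) (λ _ → refl) refl
    record { items≡ = m≡ ; subsets≡ = refl
           ; step≡ = trans (+-comm _ 1) (trans (cong suc K≡) (sym (+-identityʳ (suc K)))) ; stored = tt }
  where
  σ′ : Store
  σ′ = proj₁ (⟦ step ≔ var numColours ⊕ con 1 ▸ numSubsets ≔ con 1 ▸ kindNo ≔ con 0 ⟧ (σ , xs))
... | inv , t =
  subst (λ n → Listed (suc K) (expand (σ count) n) (proj₁ (⟦ items ⟧ (σ , xs)))) n≡ inv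
  , within-▸ (within-const (step ≔ var numColours ⊕ con 1) _ (σ , xs) 1≤G ≤-refl)
   (within-▸ (within-const (numSubsets ≔ con 1) _ _ 1≤G ≤-refl)
   (within-▸ (within-const (kindNo ≔ con 0) _ _ 1≤G ≤-refl)
             (within-for (triangle ! var numPairs) listKind (listCost + 3) _ 1≤G
               (*-bound (listCost + 3) t (≤-trans (≤-reflexive n≡) n≤G)))))
  where
  n≡ : σ triangle (σ numPairs 0) ≡ tri (tri (suc K))
  n≡ = trans (cong (σ triangle) N≡) (Tally.triangle≡ tally _ ≤-refl)

-- Initialising the table of ways

record Base (n : ℕ) (σ : Store) : Set where
  field
    slot≡ : σ slot 0 ≡ n
    ones  : ∀ i → i < n → σ ways i ≡ 1
    zeros : ∀ i → n ≤ i → σ ways i ≡ 0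

baseCost : ℕ
baseCost = cost (ways ⟨ var slot ⟩≔ con 1 ▸ slot ≔ var slot ⊕ con 1) (start []) + 3

base-loop : ∀ n σ xs → Base 0 σ → let c = ways ⟨ var slot ⟩≔ con 1 ▸ slot ≔ var slot ⊕ con 1 in
  Base n (proj₁ (iter n ⟦ c ⟧ (σ , xs))) × loopCost (cost c) ⟦ c ⟧ n (σ , xs) ≤ n * baseCost
base-loop n σ xs inv with loop-rule c I (cost c (start [])) body n (σ , xs) (0 , refl , inv)
  where
  c : Cmd
  c = ways ⟨ var slot ⟩≔ con 1 ▸ slot ≔ var slot ⊕ con 1
  I : ℕ → Mem → Set
  I k (σ , _) = ∃[ j ] j + k ≡ n × Base j σ
  body : ∀ k μ → I (suc k) μ → I k (⟦ c ⟧ μ) × cost c μ ≤ cost c (start [])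
  body k (σ , xs) (j , j+k , inv) = (suc j , trans (sym (+-suc j k)) j+k , record
    { slot≡ = trans (+-comm _ 1) (cong suc slot≡) ; ones = ones′
    ; zeros = λ i j<i → trans (if-≢ (λ eq → <⇒≢ j<i (sym (trans eq slot≡)))) (zeros i (<⇒≤ j<i)) }) , ≤-refl
    where
    open Base inv
    ones′ : ∀ i → i < suc j → proj₁ (⟦ c ⟧ (σ , xs)) ways i ≡ 1
    ones′ i i≤j with i ≟ σ slot 0
    ... | yes eq = if-≡ eq
    ... | no i≢  = trans (if-≢ i≢) (ones i (≤∧≢⇒< (≤-pred i≤j) (λ eq → i≢ (trans eq (sym slot≡)))))
... | (j , j+0 , inv′) , t with trans (sym (+-identityʳ j)) j+0
... | refl = inv′ , t

base-correct : ∀ {K} σ xs {G} → 1 ≤ G → suc K ≤ G → σ numColours 0 ≡ K → Base 0 σ →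
  Base (suc K) (proj₁ (⟦ base ⟧ (σ , xs)))
  × Within G base (expCost (var numColours ⊕ con 1) + 4 + (baseCost + 1)) (σ , xs)
base-correct {K} σ xs 1≤G K<G refl inv with base-loop (K + 1) σ xs inv
... | inv′ , t = subst (λ n → Base n (proj₁ (⟦ base ⟧ (σ , xs)))) (+-comm K 1) inv′
  , within-for (var numColours ⊕ con 1) _ baseCost (σ , xs) 1≤G
      (*-bound baseCost t (≤-trans (≤-reflexive (+-comm K 1)) K<G))

-- The table of ways

-- Row and column are quotient and remainder of the address modulo K + 1.
cell-injective : ∀ {K s s′ c c′} → c ≤ K → c′ ≤ K → s * suc K + c ≡ s′ * suc K + c′ → s ≡ s′ × c ≡ c′
cell-injective {K} {s} {s′} {c} {c′} c≤ c′≤ eq = s≡ , +-cancelˡ-≡ (s * suc K) c c′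
    (trans eq (cong (λ s → s * suc K + c′) (sym s≡)))
  where
  quotient : ∀ s {c} → c ≤ K → (s * suc K + c) / suc K ≡ s
  quotient s {c} c≤ = trans (cong (_/ suc K) (+-comm (s * suc K) c))
    (trans (+-distrib-/-∣ʳ c (n∣m*n s)) (cong₂ _+_ (m<n⇒m/n≡0 (s≤s c≤)) (m*n/n≡m s (suc K))))
  s≡ : s ≡ s′
  s≡ = trans (sym (quotient s c≤)) (trans (cong (_/ suc K) eq) (quotient s′ c′≤))

bumped : (ℕ → ℕ) → ℕ → ℕ → ℕ → ℕ
bumped D i j a = if a ≡ᵇ i then D i + D j else D a

bumped-mono : ∀ {D a} i j → 0 < D a → 0 < bumped D i j a
bumped-mono {D} {a} i j 0<D with a ≟ i
... | yes refl = subst (0 <_) (sym (if-≡ {i = a} refl)) (≤-trans 0<D (m≤m+n _ _))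
... | no a≢i   = subst (0 <_) (sym (if-≢ a≢i)) 0<D

bumped-new : ∀ {D} i j → 0 < D j → 0 < bumped D i j i
bumped-new {D} i j 0<D = subst (0 <_) (sym (if-≡ {i = i} refl)) (≤-trans 0<D (m≤n+m _ (D i)))

bumped-old : ∀ {D a} i j → 0 < bumped D i j a → 0 < D a ⊎ (a ≡ i × 0 < D j)
bumped-old {D} {a} i j 0<D with a ≟ i
... | no a≢i   = inj₁ (subst (0 <_) (if-≢ a≢i) 0<D)
... | yes refl with D a in eq
...   | suc _ = inj₁ (s≤s z≤n)
...   | zero  = inj₂ (refl , subst (0 <_) (if-≡ {i = a} refl) 0<D)

-- Abstract because nested uses of `joined`, which repeats D, would unfold to
-- huge terms.
abstract
  joined : (ℕ → ℕ) → ℕ → ℕ → ℕ → ℕ → ℕ → ℕ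
  joined D S P x y = bumped (bumped D (S + x) (P + y)) S (P + y)

  prepend-ways : ∀ a b μ → (toℕ b ≡ᵇ toℕ ways) ≡ false → let σ = proj₁ μ in
    proj₁ (⟦ prepend a b ⟧ μ) ways
    ≡ joined (σ ways) (σ subset 0) (σ smaller 0) (σ a (σ kindNo 0)) (σ b (σ kindNo 0))
  prepend-ways a b μ b≢ rewrite b≢ = refl

  joined-mono : ∀ {D a} S P x y → 0 < D a → 0 < joined D S P x y a
  joined-mono {D} S P x y 0<D =
    bumped-mono {bumped D (S + x) (P + y)} S (P + y) (bumped-mono {D} (S + x) (P + y) 0<D)

  joined-new : ∀ {D} S P x y → 0 < D (P + y) → 0 < joined D S P x y (S + x) × 0 < joined D S P x y (S + 0)
  joined-new {D} S P x y 0<D =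
    bumped-mono {bumped D (S + x) (P + y)} S (P + y) (bumped-new {D} (S + x) (P + y) 0<D)
    , subst (λ a → 0 < joined D S P x y a) (sym (+-identityʳ S))
        (bumped-new {bumped D (S + x) (P + y)} S (P + y) (bumped-mono {D} (S + x) (P + y) 0<D))

  -- If the second `bumped` reads the cell that the first has just changed, its positivity still
  -- goes back to `D (P + y)`; the rows S and P may therefore overlap.
  joined-old : ∀ {D a} S P x y → 0 < joined D S P x y a →
               0 < D a ⊎ ((a ≡ S + x ⊎ a ≡ S + 0) × 0 < D (P + y))
  joined-old {D} {a} S P x y 0<J with bumped-old {bumped D (S + x) (P + y)} S (P + y) 0<J
  ... | inj₂ (a≡S , 0<D′) with bumped-old {D} (S + x) (P + y) 0<D′
  ...   | inj₁ 0<D       = inj₂ (inj₂ (trans a≡S (sym (+-identityʳ S))) , 0<D)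
  ...   | inj₂ (_ , 0<D) = inj₂ (inj₂ (trans a≡S (sym (+-identityʳ S))) , 0<D)
  joined-old {D} {a} S P x y 0<J | inj₁ 0<D′ with bumped-old {D} (S + x) (P + y) 0<D′
  ... | inj₁ 0<D        = inj₁ 0<D
  ... | inj₂ (a≡ , 0<D) = inj₂ (inj₁ a≡ , 0<D)

module Table (K : ℕ) (zs : List ℕ) where

  W : ℕ
  W = suc K

  Cell : ℕ → ℕ → Set
  Cell s zero    = Row (sel zs s)
  Cell s (suc c) = RowFrom (suc c) (sel zs s)

  -- Soundness concerns all rows at once, whereas completeness, `Done`, grows with the rows filled
  -- so far.
  Sound : (ℕ → ℕ) → Set
  Sound D = ∀ s c → s < 2 ^ length zs → c ≤ K → 0 < D (s * W + c) → Cell s c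

  Done : (ℕ → ℕ) → ℕ → Set
  Done D n = ∀ s c → s < n → c ≤ K → Cell s c → 0 < D (s * W + c)

  rowFrom⇒cell : ∀ {s c} → 1 ≤ c → RowFrom c (sel zs s) → Cell s c
  rowFrom⇒cell {c = suc c} _ r = r

  row-cons : ∀ {s p z x y} → sel zs s ↭ z ∷ sel zs p → Fits z x y → RowFrom y (sel zs p) → RowFrom x (sel zs s)
  row-cons {z = z} {x} {y} q f (ds , c , path , kinds) =
    tile z x y ∷ ds , c , f ∷ path , ↭-trans (↭-prep z kinds) (↭-sym q)

  joined-sound : ∀ {D s p z x y} → s < 2 ^ length zs → p < 2 ^ length zs → sel zs s ↭ z ∷ sel zs p →
    Fits z x y → 1 ≤ x × x ≤ K → 1 ≤ y × y ≤ K → Sound D → Sound (joined D (s * W) (p * W) x y)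
  joined-sound {D} {s} {p} {z} {suc x} {suc y} s< p< q f (_ , x≤) (_ , y≤) sound s₁ c s₁< c≤ 0<D
    with joined-old {D} (s * W) (p * W) (suc x) (suc y) 0<D
  ... | inj₁ 0<D₀ = sound s₁ c s₁< c≤ 0<D₀
  ... | inj₂ (inj₁ a≡ , 0<Dp) with cell-injective {K} {s₁} {s} c≤ x≤ a≡
  ...   | refl , refl = row-cons q f (sound p (suc y) p< y≤ 0<Dp)
  joined-sound {D} {s} {p} {z} {suc x} {suc y} s< p< q f (_ , x≤) (_ , y≤) sound s₁ c s₁< c≤ 0<D
      | inj₂ (inj₂ a≡ , 0<Dp) with cell-injective {K} {s₁} {s} c≤ z≤n a≡
  ...   | refl , refl = suc x , row-cons q f (sound p (suc y) p< y≤ 0<Dp)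

  record Setting (σ : Store) : Set where
    field
      colours≡ : σ numColours 0 ≡ K
      items≡   : σ numItems 0 ≡ length zs
      stored   : Stored W zs σ
      known    : ∀ z → z ∈ zs → Known K σ z

  pick-∈ : ∀ {ys s z i} → Pick ys s z i → z ∈ ys
  pick-∈ (found _)  = here refl
  pick-∈ (take _ p) = there (pick-∈ p)
  pick-∈ (skip _ p) = there (pick-∈ p)

  -- What trying item i must achieve: every row of s that starts with this item is accounted for.
  Filled : (ℕ → ℕ) → ℕ → ℕ → ℕ → Set
  Filled D s z i = ∀ x y → Fits z x y → Cell (s ∸ 2 ^ i) y → 0 < D (s * W + x) × 0 < D (s * W + 0)

  extended : (ℕ → ℕ) → (S P r t l b : ℕ) → ℕ → ℕ
  extended D S P r t l b =
    joined (joined (joined (joined D S P l r) S P t b) S P r l) S P b t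

  extended-mono : ∀ D S P r t l b {a} → 0 < D a → 0 < extended D S P r t l b a
  extended-mono D S P r t l b 0<D =
    joined-mono {joined (joined (joined D S P l r) S P t b) S P r l} S P b t
      (joined-mono {joined (joined D S P l r) S P t b} S P r l
        (joined-mono {joined D S P l r} S P t b (joined-mono {D} S P l r 0<D)))

  extended-sound : ∀ {D s p z r t l b} → s < 2 ^ length zs → p < 2 ^ length zs → sel zs s ↭ z ∷ sel zs p →
    KnownKind K z r t l b → Sound D → Sound (extended D (s * W) (p * W) r t l b)
  extended-sound {r = r} {t} {l} {b} s< p< q k sound =
    joined-sound s< p< q (turned-by (suc (suc (suc zero)))) bottom∈ top∈
      (joined-sound s< p< q (turned-by (suc (suc zero))) right∈ left∈
        (joined-sound s< p< q (turned-by (suc zero)) top∈ bottom∈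
          (joined-sound s< p< q (turned-by zero) left∈ right∈ sound)))
    where
    open KnownKind k
    turned-by : ∀ k → let (x , y) = sides r t l b k in Fits _ x y
    turned-by k = subst (λ z → Fits z (proj₁ (sides r t l b k)) (proj₂ (sides r t l b k))) (sym kind≡)
                        (fits-sides r t l b k)

  -- The quarter turn that shows x and y selects one of the four joins; the other joins never make a
  -- positive cell zero.
  extended-new : ∀ {D S P z r t l b x y} → KnownKind K z r t l b → Fits z x y → 0 < D (P + y) →
    0 < extended D S P r t l b (S + x) × 0 < extended D S P r t l b (S + 0)
  extended-new {D} {S} {P} {z} {r} {t} {l} {b} {x} {y} k f 0<D
    with fits⇒sides r t l b (subst (λ z → Fits z x y) (KnownKind.kind≡ k) f)
  ... | zero , refl = let u , v = joined-new {D} S P l r 0<D in up u , up v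
    where
    up : ∀ {a} → 0 < joined D S P l r a → 0 < extended D S P r t l b a
    up h = joined-mono {joined (joined (joined D S P l r) S P t b) S P r l} S P b t
      (joined-mono {joined (joined D S P l r) S P t b} S P r l (joined-mono {joined D S P l r} S P t b h))
  ... | suc zero , refl =
    let u , v = joined-new {joined D S P l r} S P t b (joined-mono {D} S P l r 0<D) in up u , up v
    where
    up : ∀ {a} → 0 < joined (joined D S P l r) S P t b a → 0 < extended D S P r t l b a
    up h = joined-mono {joined (joined (joined D S P l r) S P t b) S P r l} S P b t
      (joined-mono {joined (joined D S P l r) S P t b} S P r l h)
  ... | suc (suc zero) , refl =
    let u , v = joined-new {joined (joined D S P l r) S P t b} S P r l
                  (joined-mono {joined D S P l r} S P t b (joined-mono {D} S P l r 0<D)) in up u , up v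
    where
    up : ∀ {a} → 0 < joined (joined (joined D S P l r) S P t b) S P r l a → 0 < extended D S P r t l b a
    up = joined-mono {joined (joined (joined D S P l r) S P t b) S P r l} S P b t
  ... | suc (suc (suc zero)) , refl =
    joined-new {joined (joined (joined D S P l r) S P t b) S P r l} S P b t
      (joined-mono {joined (joined D S P l r) S P t b} S P r l
        (joined-mono {joined D S P l r} S P t b (joined-mono {D} S P l r 0<D)))

  known-colour : ∀ {z r t l b x y} → KnownKind K z r t l b → Fits z x y → 1 ≤ y × y ≤ K
  known-colour {r = r} {t} {l} {b} {x} {y} k f
    with fits⇒sides r t l b (subst (λ z → Fits z x y) (KnownKind.kind≡ k) f)
  ... | zero , refl                   = KnownKind.right∈ k
  ... | suc zero , refl               = KnownKind.bottom∈ k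
  ... | suc (suc zero) , refl         = KnownKind.left∈ k
  ... | suc (suc (suc zero)) , refl   = KnownKind.top∈ k

  -- A row of a nonempty subset has a first tile. Its kind is picked at some digit i, and the
  -- remaining tiles form a row of s minus 2 ^ i, to which `Filled` applies.
  filled⇒done : ∀ {D s} → 0 < s → s < 2 ^ length zs →
    (∀ z → z ∈ zs → ∃[ r ] ∃[ t ] ∃[ l ] ∃[ b ] KnownKind K z r t l b) →
    (∀ z i → Pick zs s z i → Filled D s z i) → Done D s → Done D (suc s)
  filled⇒done {D} {s} 0<s s< known filled done s′ c s′<1+s c≤ cell with s′ ≟ s
  ... | no s′≢s = done s′ c (≤∧≢⇒< (≤-pred s′<1+s) s′≢s) c≤ cell
  ... | yes refl = go c cell
    where
    both : ∀ x → RowFrom x (sel zs s) → 0 < D (s * W + x) × 0 < D (s * W + 0)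
    both x ([] , _ , _ , kinds) = ⊥-elim (sel-nonempty zs 0<s s< (↭-empty-inv (↭-sym kinds)))
    both x (tile z .x y ∷ ds , c′ , f ∷ path , kinds) with sel-pick zs (∈-resp-↭ kinds (here refl))
    ... | i , pick with known z (pick-∈ pick)
    ... | _ , _ , _ , _ , k = filled z i pick x y f
      (rowFrom⇒cell (proj₁ (known-colour k f)) (ds , c′ , path , drop-∷ (↭-trans kinds (pick-sel s< pick))))
    go : ∀ c → Cell s c → 0 < D (s * W + c)
    go zero    (x , row) = proj₂ (both x row)
    go (suc x) row       = proj₁ (both (suc x) row)

-- Filling the table of ways

record Prepending (S P z r t l b : ℕ) (μ : Mem) : Set where
  field
    subset≡  : proj₁ μ subset 0 ≡ S
    smaller≡ : proj₁ μ smaller 0 ≡ P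
    kindNo≡  : proj₁ μ kindNo 0 ≡ z
    right≡   : proj₁ μ rightOf z ≡ r
    top≡     : proj₁ μ topOf z ≡ t
    left≡    : proj₁ μ leftOf z ≡ l
    bottom≡  : proj₁ μ bottomOf z ≡ b

prepend-keeps : ∀ {S P z r t l b} a a′ μ → Prepending S P z r t l b μ → Prepending S P z r t l b (⟦ prepend a a′ ⟧ μ)
prepend-keeps {z = z} a a′ μ p = record
  { subset≡  = trans (frame (prepend a a′) refl μ 0) subset≡
  ; smaller≡ = trans (frame (prepend a a′) refl μ 0) smaller≡
  ; kindNo≡  = trans (frame (prepend a a′) refl μ 0) kindNo≡
  ; right≡   = trans (frame (prepend a a′) refl μ z) right≡
  ; top≡     = trans (frame (prepend a a′) refl μ z) top≡
  ; left≡    = trans (frame (prepend a a′) refl μ z) left≡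
  ; bottom≡  = trans (frame (prepend a a′) refl μ z) bottom≡
  }
  where open Prepending p

prepend-joins : ∀ {S P z r t l b x y D} a a′ μ → (toℕ a′ ≡ᵇ toℕ ways) ≡ false → Prepending S P z r t l b μ →
  proj₁ μ a z ≡ x → proj₁ μ a′ z ≡ y → proj₁ μ ways ≡ D →
  proj₁ (⟦ prepend a a′ ⟧ μ) ways ≡ joined D S P x y
prepend-joins a a′ μ a′≢ record { subset≡ = refl ; smaller≡ = refl ; kindNo≡ = refl } refl refl refl =
  prepend-ways a a′ μ a′≢

joins-in-turn : ∀ {S P z r t l b x₁ y₁ x₂ y₂ x₃ y₃ x₄ y₄} c₁ c₂ c₃ c₄ →
  let Joins = λ c x y → ∀ μ {D} → Prepending S P z r t l b μ → proj₁ μ ways ≡ D →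
                Prepending S P z r t l b (⟦ c ⟧ μ) × proj₁ (⟦ c ⟧ μ) ways ≡ joined D S P x y in
  Joins c₁ x₁ y₁ → Joins c₂ x₂ y₂ → Joins c₃ x₃ y₃ → Joins c₄ x₄ y₄ →
  ∀ μ → Prepending S P z r t l b μ → proj₁ (⟦ c₁ ▸ c₂ ▸ c₃ ▸ c₄ ⟧ μ) ways
    ≡ joined (joined (joined (joined (proj₁ μ ways) S P x₁ y₁) S P x₂ y₂) S P x₃ y₃) S P x₄ y₄
joins-in-turn c₁ c₂ c₃ c₄ j₁ j₂ j₃ j₄ μ p with j₁ μ p refl
... | p₁ , e₁ with j₂ _ p₁ e₁
... | p₂ , e₂ with j₃ _ p₂ e₂
... | p₃ , e₃ = proj₂ (j₄ _ p₃ e₃)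

tryCost : ℕ → ℕ
tryCost k = cost (item ≔ var item ⊖ con 1) (start [])
          + (expCost (con 1 ⊖ (weight ! var item ⊖ var rest)) + 4 + (k + 3 + 1))

module Search (K : ℕ) (zs : List ℕ) where

  open Table K zs

  prependAll-ways : ∀ {S P z r t l b} μ → Prepending S P z r t l b μ →
    proj₁ (⟦ prependAll ⟧ μ) ways ≡ extended (proj₁ μ ways) S P r t l b
  prependAll-ways {S} {P} {z} {r} {t} {l} {b} μ p =
    joins-in-turn (prepend leftOf rightOf) (prepend topOf bottomOf)
      (prepend rightOf leftOf) (prepend bottomOf topOf)
      (λ μ p e → prepend-keeps leftOf rightOf μ p
               , prepend-joins leftOf rightOf μ refl p (Prepending.left≡ p) (Prepending.right≡ p) e)
      (λ μ p e → prepend-keeps topOf bottomOf μ p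
               , prepend-joins topOf bottomOf μ refl p (Prepending.top≡ p) (Prepending.bottom≡ p) e)
      (λ μ p e → prepend-keeps rightOf leftOf μ p
               , prepend-joins rightOf leftOf μ refl p (Prepending.right≡ p) (Prepending.left≡ p) e)
      (λ μ p e → prepend-keeps bottomOf topOf μ p
               , prepend-joins bottomOf topOf μ refl p (Prepending.bottom≡ p) (Prepending.top≡ p) e)
      μ p

  useItem-ways : ∀ σ xs → let z = σ itemKind (σ item 0) in
    proj₁ (⟦ useItem ⟧ (σ , xs)) ways
    ≡ extended (σ ways) (σ subset 0) (σ subset 0 ∸ σ weight (σ item 0))
               (σ rightOf z) (σ topOf z) (σ leftOf z) (σ bottomOf z)
  useItem-ways σ xs = prependAll-ways (⟦ lookupItem ⟧ (σ , xs)) record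
    { subset≡ = refl ; smaller≡ = refl ; kindNo≡ = refl ; right≡ = refl ; top≡ = refl ; left≡ = refl ; bottom≡ = refl }

  -- Loop invariant for filling row s: ys are the items still to be tried, and
  -- r is the part of s that refers to them.
  record Trying (s : ℕ) (ys : List ℕ) (r : ℕ) (σ : Store) : Set where
    field
      setting  : Setting σ
      subset≡  : σ subset 0 ≡ s * W
      item≡    : σ item 0 ≡ length ys
      rest≡    : σ rest 0 ≡ r * W
      r<       : r < 2 ^ length ys
      storedYs : Stored W ys σ
      sound    : Sound (σ ways)
      done     : Done (σ ways) s
      todo     : ∀ z i → Pick ys r z i → Pick zs s z i
      tried    : ∀ z i → Pick zs s z i → Pick ys r z i ⊎ Filled (σ ways) s z i

  -- The state between decrementing `item` and deciding its digit: `item` already points at y, while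
  -- r still contains the digit of y.
  record Ready (s : ℕ) (y : ℕ) (ys : List ℕ) (r : ℕ) (σ : Store) : Set where
    field
      setting  : Setting σ
      subset≡  : σ subset 0 ≡ s * W
      item≡    : σ item 0 ≡ length ys
      kind≡    : σ itemKind (length ys) ≡ y
      weight≡  : σ weight (length ys) ≡ 2 ^ length ys * W
      rest≡    : σ rest 0 ≡ r * W
      r<       : r < 2 ^ suc (length ys)
      storedYs : Stored W ys σ
      sound    : Sound (σ ways)
      done     : Done (σ ways) s
      todo     : ∀ z i → Pick (y ∷ ys) r z i → Pick zs s z i
      tried    : ∀ z i → Pick zs s z i → Pick (y ∷ ys) r z i ⊎ Filled (σ ways) s z i

  skip-correct : ∀ {s y ys r σ} → r < 2 ^ length ys → Ready s y ys r σ → Trying s ys r σ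
  skip-correct {s} {y} {ys} {r} {σ} h ready = record
    { setting = setting ; subset≡ = subset≡ ; item≡ = item≡ ; rest≡ = rest≡ ; r< = h
    ; storedYs = storedYs ; sound = sound ; done = done
    ; todo = λ z i p → todo z i (skip h p)
    ; tried = λ z i p → tried′ (tried z i p) }
    where
    open Ready ready
    tried′ : ∀ {z i} → Pick (y ∷ ys) r z i ⊎ Filled (σ ways) s z i → Pick ys r z i ⊎ Filled (σ ways) s z i
    tried′ (inj₁ (found h′))  = ⊥-elim (<⇒≱ h h′)
    tried′ (inj₁ (take h′ _)) = ⊥-elim (<⇒≱ h h′)
    tried′ (inj₁ (skip _ p))  = inj₁ p
    tried′ (inj₂ f)           = inj₂ f

  useItem-correct : ∀ {s y ys r} μ → s < 2 ^ length zs → 2 ^ length ys ≤ r → Ready s y ys r (proj₁ μ) →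
                    Trying s ys (r ∸ 2 ^ length ys) (proj₁ (⟦ useItem ⟧ μ))
  useItem-correct {s} {y} {ys} {r} (σ , xs) s< h ready = record
    { setting  = record { colours≡ = Setting.colours≡ setting ; items≡ = Setting.items≡ setting
                        ; stored = stored-cong {σ = σ} zs (λ _ _ → refl) (λ _ _ → refl) (Setting.stored setting)
                        ; known = Setting.known setting }
    ; subset≡  = subset≡
    ; item≡    = item≡
    ; rest≡    = trans (cong₂ _∸_ rest≡ weight≡′) (sym (*-distribʳ-∸ W r (2 ^ length ys)))
    ; r<       = digit-bound (length ys) r<
    ; storedYs = stored-cong {σ = σ} ys (λ _ _ → refl) (λ _ _ → refl) storedYs
    ; sound    = subst Sound (sym ways≡) (extended-sound s< p< q knownY sound)
    ; done     = λ s′ c s′< c≤ cell → subst (λ D → 0 < D (s′ * W + c)) (sym ways≡) (up (done s′ c s′< c≤ cell))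
    ; todo     = λ z i p → todo z i (take h p)
    ; tried    = λ z i p → tried′ (tried z i p)
    }
    where
    open Ready ready
    weight≡′ : σ weight (σ item 0) ≡ 2 ^ length ys * W
    weight≡′ = trans (cong (σ weight) item≡) weight≡
    kind≡′ : σ itemKind (σ item 0) ≡ y
    kind≡′ = trans (cong (σ itemKind) item≡) kind≡
    p : ℕ
    p = s ∸ 2 ^ length ys
    pickY : Pick zs s y (length ys)
    pickY = todo y (length ys) (found h)
    q : sel zs s ↭ y ∷ sel zs p
    q = pick-sel s< pickY
    p<s : p < s
    p<s = ∸-monoʳ-< {s} {2 ^ length ys} {0} (m^n>0 2 (length ys)) (pick-≤ pickY)
    p< : p < 2 ^ length zs
    p< = <-trans p<s s<
    D′ : ℕ → ℕ
    D′ = extended (σ ways) (s * W) (p * W) (σ rightOf y) (σ topOf y) (σ leftOf y) (σ bottomOf y)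
    ways≡ : proj₁ (⟦ useItem ⟧ (σ , xs)) ways ≡ D′
    ways≡ = trans (useItem-ways σ xs) (trans
      (cong₂ (λ S P → extended (σ ways) S P (σ rightOf z) (σ topOf z) (σ leftOf z) (σ bottomOf z)) subset≡
        (trans (cong₂ _∸_ subset≡ weight≡′) (sym (*-distribʳ-∸ W s (2 ^ length ys)))))
      (cong (λ z → extended (σ ways) (s * W) (p * W) (σ rightOf z) (σ topOf z) (σ leftOf z) (σ bottomOf z)) kind≡′))
      where
      z : ℕ
      z = σ itemKind (σ item 0)
    knownY : KnownKind K y (σ rightOf y) (σ topOf y) (σ leftOf y) (σ bottomOf y)
    knownY = Setting.known setting y (pick-∈ pickY)
    up : ∀ {a} → 0 < σ ways a → 0 < D′ a
    up = extended-mono (σ ways) (s * W) (p * W) (σ rightOf y) (σ topOf y) (σ leftOf y) (σ bottomOf y)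
    filledY : Filled D′ s y (length ys)
    filledY x c f cell =
      extended-new knownY f (done p c p<s (proj₂ (known-colour knownY f)) cell)
    tried′ : ∀ {z i} → Pick (y ∷ ys) r z i ⊎ Filled (σ ways) s z i →
             Pick ys (r ∸ 2 ^ length ys) z i ⊎ Filled (proj₁ (⟦ useItem ⟧ (σ , xs)) ways) s z i
    tried′ (inj₁ (found _))    = inj₂ (subst (λ D → Filled D s y (length ys)) (sym ways≡) filledY)
    tried′ (inj₁ (take _ p))   = inj₁ p
    tried′ (inj₁ (skip h′ _))  = ⊥-elim (<⇒≱ h′ h)
    tried′ {z} {i} (inj₂ f)    = inj₂ (subst (λ D → Filled D s z i) (sym ways≡)
      (λ x c fit cell → let u , v = f x c fit cell in up u , up v))

  -- Stated for an arbitrary command because `useItem` unfolds to a huge term.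
  tryWith-correct : ∀ use k → (∀ μ → cost use μ ≤ k) →
    (∀ {s y ys r} μ → s < 2 ^ length zs → 2 ^ length ys ≤ r → Ready s y ys r (proj₁ μ) →
      Trying s ys (r ∸ 2 ^ length ys) (proj₁ (⟦ use ⟧ μ))) →
    ∀ {s y ys r} μ → s < 2 ^ length zs → Trying s (y ∷ ys) r (proj₁ μ) →
    (∃[ r′ ] Trying s ys r′ (proj₁ (⟦ tryWith use ⟧ μ))) × cost (tryWith use) μ ≤ tryCost k
  tryWith-correct use k use≤k use-correct {s} {y} {ys} {r} (σ , xs) s< trying = choose (2 ^ length ys ≤? r)
    where
    open Trying trying
    μ′ : Mem
    μ′ = ⟦ item ≔ var item ⊖ con 1 ⟧ (σ , xs)
    n : ℕ
    n = eval (con 1 ⊖ (weight ! var item ⊖ var rest)) (proj₁ μ′)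
    item≡′ : σ item 0 ∸ 1 ≡ length ys
    item≡′ = cong (_∸ 1) item≡
    ready : Ready s y ys r (proj₁ μ′)
    ready = record
      { setting = record { colours≡ = Setting.colours≡ setting ; items≡ = Setting.items≡ setting
                         ; stored = stored-cong {σ = σ} zs (λ _ _ → refl) (λ _ _ → refl) (Setting.stored setting)
                         ; known = Setting.known setting }
      ; subset≡ = subset≡ ; item≡ = item≡′ ; kind≡ = proj₁ storedYs ; weight≡ = proj₁ (proj₂ storedYs)
      ; rest≡ = rest≡ ; r< = r<
      ; storedYs = stored-cong {σ = σ} ys (λ _ _ → refl) (λ _ _ → refl) (proj₂ (proj₂ storedYs))
      ; sound = sound ; done = done ; todo = todo ; tried = tried }
    n≡ : n ≡ 1 ∸ (2 ^ length ys ∸ r) * W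
    n≡ = cong (1 ∸_) (trans (cong₂ _∸_ (trans (cong (σ weight) item≡′) (proj₁ (proj₂ storedYs))) rest≡)
           (sym (*-distribʳ-∸ W (2 ^ length ys) r)))
    iterations : ∀ n → n ≤ 1 → loopCost (cost use) ⟦ use ⟧ n μ′ ≤ k + 3
    iterations zero          _        = z≤n
    iterations (suc zero)    _        = ≤-trans (≤-reflexive (+-identityʳ _)) (+-monoˡ-≤ 3 (use≤k μ′))
    iterations (suc (suc _)) (s≤s ())
    paid : n ≤ 1 → cost (tryWith use) (σ , xs) ≤ tryCost k
    paid n≤1 = +-monoʳ-≤ (cost (item ≔ var item ⊖ con 1) (start []))
      (+-monoʳ-≤ (expCost (con 1 ⊖ (weight ! var item ⊖ var rest)) + 4) (+-monoˡ-≤ 1 (iterations n n≤1)))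
    choose : Dec (2 ^ length ys ≤ r) →
      (∃[ r′ ] Trying s ys r′ (proj₁ (⟦ tryWith use ⟧ (σ , xs)))) × cost (tryWith use) (σ , xs) ≤ tryCost k
    choose (yes h) =
      (_ , subst (λ n → Trying s ys (r ∸ 2 ^ length ys) (proj₁ (iter n ⟦ use ⟧ μ′))) (sym n≡1)
             (use-correct μ′ s< h ready))
      , paid (≤-reflexive n≡1)
      where
      n≡1 : n ≡ 1
      n≡1 = trans n≡ (cong (λ d → 1 ∸ d * W) (m≤n⇒m∸n≡0 h))
    choose (no h) =
      (_ , subst (λ n → Trying s ys r (proj₁ (iter n ⟦ use ⟧ μ′))) (sym n≡0) (skip-correct (≰⇒> h) ready))
      , paid (≤-trans (≤-reflexive n≡0) z≤n)
      where
      n≡0 : n ≡ 0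
      -- A positive difference stays positive when scaled by W, so it uses up the 1.
      n≡0 = trans n≡ (m≤n⇒m∸n≡0 (≤-trans (m<n⇒0<n∸m (≰⇒> h)) (m≤m*n (2 ^ length ys ∸ r) W)))

  Tries : Cmd → ℕ → Set
  Tries try k = ∀ {s y ys r} μ → s < 2 ^ length zs → Trying s (y ∷ ys) r (proj₁ μ) →
    (∃[ r′ ] Trying s ys r′ (proj₁ (⟦ try ⟧ μ))) × cost try μ ≤ k

  trying-loop : ∀ {try k s} → Tries try k → s < 2 ^ length zs → ∀ ys r μ → Trying s ys r (proj₁ μ) →
    Trying s [] 0 (proj₁ (iter (length ys) ⟦ try ⟧ μ))
    × loopCost (cost try) ⟦ try ⟧ (length ys) μ ≤ length ys * (k + 3)
  trying-loop {try} {k} {s} tries s< ys r μ trying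
    with loop-rule try I k body (length ys) μ (ys , r , refl , trying)
    where
    I : ℕ → Mem → Set
    I k (σ , _) = ∃[ ys ] ∃[ r ] length ys ≡ k × Trying s ys r σ
    body : ∀ n μ → I (suc n) μ → I n (⟦ try ⟧ μ) × cost try μ ≤ k
    body n μ (y ∷ ys , r , len , trying) with tries μ s< trying
    ... | (r′ , trying′) , t = (ys , r′ , suc-injective len , trying′) , t
  ... | ([] , r′ , refl , trying′) , t =
    subst (λ r → Trying s [] r (proj₁ (iter (length ys) ⟦ try ⟧ μ))) (n<1⇒n≡0 (Trying.r< trying′)) trying′ , t

  record Filling (s : ℕ) (σ : Store) : Set where
    field
      setting : Setting σ
      subset≡ : σ subset 0 ≡ s * W
      sound   : Sound (σ ways)
      done    : Done (σ ways) (suc s)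

  nextCost : ℕ → ℕ
  nextCost k = cost (subset ≔ var subset ⊕ (var numColours ⊕ con 1)) (start [])
    + (cost (rest ≔ var subset) (start []) + (cost (item ≔ var numItems) (start [])
    + (expCost (var numItems) + 4 + (length zs * (k + 3) + 1))))

  Advances : Cmd → ℕ → Set
  Advances next k = ∀ {s} → suc s < 2 ^ length zs → ∀ μ → Filling s (proj₁ μ) →
    Filling (suc s) (proj₁ (⟦ next ⟧ μ)) × cost next μ ≤ k

  nextWith-correct : ∀ try {k} → Tries try k → Advances (nextWith try) (nextCost k)
  nextWith-correct try {k} tries {s} s< (σ , xs) filling = after , paid
    where
    open Filling filling
    σ′ : Store
    σ′ = proj₁ (⟦ subset ≔ var subset ⊕ (var numColours ⊕ con 1) ▸ rest ≔ var subset ▸ item ≔ var numItems ⟧ (σ , xs))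
    setting′ : Setting σ′
    setting′ = record { colours≡ = Setting.colours≡ setting ; items≡ = Setting.items≡ setting
                      ; stored = stored-cong {σ = σ} zs (λ _ _ → refl) (λ _ _ → refl) (Setting.stored setting)
                      ; known = Setting.known setting }
    subset≡′ : σ subset 0 + (σ numColours 0 + 1) ≡ suc s * W
    subset≡′ = trans (cong₂ _+_ subset≡ (trans (+-comm _ 1) (cong suc (Setting.colours≡ setting)))) (+-comm (s * W) W)
    trying : Trying (suc s) zs (suc s) σ′
    trying = record
      { setting = setting′ ; subset≡ = subset≡′ ; item≡ = Setting.items≡ setting ; rest≡ = subset≡′ ; r< = s<
      ; storedYs = Setting.stored setting′ ; sound = sound ; done = done
      ; todo = λ _ _ p → p ; tried = λ _ _ p → inj₁ p }
    result : Trying (suc s) [] 0 (proj₁ (iter (length zs) ⟦ try ⟧ (σ′ , xs)))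
             × loopCost (cost try) ⟦ try ⟧ (length zs) (σ′ , xs) ≤ length zs * (k + 3)
    result = trying-loop {try} tries s< zs (suc s) (σ′ , xs) trying
    final : Trying (suc s) [] 0 (proj₁ (⟦ nextWith try ⟧ (σ , xs)))
    final = subst (λ n → Trying (suc s) [] 0 (proj₁ (iter n ⟦ try ⟧ (σ′ , xs))))
                  (sym (Setting.items≡ setting)) (proj₁ result)
    after : Filling (suc s) (proj₁ (⟦ nextWith try ⟧ (σ , xs)))
    after = record
      { setting = Trying.setting final ; subset≡ = Trying.subset≡ final ; sound = Trying.sound final
      ; done = filled⇒done {proj₁ (⟦ nextWith try ⟧ (σ , xs)) ways} (s≤s z≤n) s<
                 (λ z z∈ → _ , _ , _ , _ , Setting.known setting z z∈) filled (Trying.done final) }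
      where
      filled : ∀ z i → Pick zs (suc s) z i → Filled (proj₁ (⟦ nextWith try ⟧ (σ , xs)) ways) (suc s) z i
      filled z i p with Trying.tried final z i p
      -- `Pick []` is empty, so each digit of the subset has been dealt with.
      ... | inj₂ f = f
    paid : cost (nextWith try) (σ , xs) ≤ nextCost k
    paid = +-monoʳ-≤ (cost (subset ≔ var subset ⊕ (var numColours ⊕ con 1)) (start []))
      (+-monoʳ-≤ (cost (rest ≔ var subset) (start [])) (+-monoʳ-≤ (cost (item ≔ var numItems) (start []))
        (+-monoʳ-≤ (expCost (var numItems) + 4) (+-monoˡ-≤ 1
          (subst (λ n → loopCost (cost try) ⟦ try ⟧ n (σ′ , xs) ≤ length zs * (k + 3))
                 (sym (Setting.items≡ setting)) (proj₂ result))))))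

  filling-loop : ∀ next {k} → Advances next k → ∀ n μ → n < 2 ^ length zs → Filling 0 (proj₁ μ) →
    Filling n (proj₁ (iter n ⟦ next ⟧ μ)) × loopCost (cost next) ⟦ next ⟧ n μ ≤ n * (k + 3)
  filling-loop next {k} advances n μ n< filling with loop-rule next I k body n μ (0 , refl , filling)
    where
    I : ℕ → Mem → Set
    I k (σ , _) = ∃[ s ] s + k ≡ n × Filling s σ
    body : ∀ j μ → I (suc j) μ → I j (⟦ next ⟧ μ) × cost next μ ≤ k
    body j μ (s , s+j , filling)
      with advances (≤-<-trans (≤-trans (m≤m+n (suc s) j) (≤-reflexive (trans (sym (+-suc s j)) s+j))) n<) μ filling
    ... | filling′ , t = (suc s , trans (sym (+-suc s j)) s+j , filling′) , t
  ... | (s , s+0 , filling′) , t with trans (sym (+-identityʳ s)) s+0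
  ...   | refl = filling′ , t

-- Correctness and running time of the program

∈-expand : ∀ {C z} n → z ∈ expand C n → 0 < C z
∈-expand {C} (suc n) z∈ with ∈-++⁻ (replicate (C n) n) z∈
... | inj₂ z∈′ = ∈-expand n z∈′
... | inj₁ z∈′ with All.lookup (replicate⁺ {P = _≡ n} (C n) refl) z∈′
...   | refl with C n
...     | suc _ = s≤s z≤n

pred-power< : ∀ {n m} → n ≡ 2 ^ m → n ∸ 1 < 2 ^ m
pred-power< {m = m} refl = ∸-monoʳ-< {2 ^ m} {1} {0} (s≤s z≤n) (m^n>0 2 m)

record Fresh (σ : Store) : Set where
  field
    items≡0  : σ numItems 0 ≡ 0
    slot≡0   : σ slot 0 ≡ 0
    subset≡0 : σ subset 0 ≡ 0
    ways≡0   : ∀ i → σ ways i ≡ 0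

initCost : ℕ
initCost = expCost (var numColours ⊕ con 1) + 4 + (baseCost + 1)

useCost stepCost searchCost : ℕ
useCost = cost useItem (start [])
stepCost = cost (subset ≔ var subset ⊕ (var numColours ⊕ con 1)) (start [])
  + (cost (rest ≔ var subset) (start []) + (cost (item ≔ var numItems) (start [])
  + (expCost (var numItems) + 4))) + 4 + (tryCost useCost + 3)
searchCost = expCost (var numSubsets ⊖ con 1) + 4 + (stepCost + 1)

matcherCost : ℕ
matcherCost = tablesCost + ((expCost (var numPieces) + 4 + (readCost + 3 + 1)) + (itemsCost + (initCost + searchCost)))

-- The number m of items depends on the puzzle, so the last bound is assumed for every m that the
-- cap of 4 per kind permits.
module Run {K : ℕ} (P : Puzzle K) {G : ℕ} (1≤G : 1 ≤ G) (M≤G : size P ≤ G) (K<G : suc K ≤ G)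
           (N≤G : tri (suc K) ≤ G) (n≤G : tri (tri (suc K)) ≤ G)
           (2^m≤G : ∀ {m} → m ≤ tri (tri (suc K)) * 4 → 2 ^ m * (m + 1) ≤ G) where

  open Reading P

  colourList : List ℕ
  colourList = concatMap (λ i → encodePiece (pieces P i)) (allFin (size P))

  record AfterTables (μ : Mem) : Set where
    field
      tables≡ : Tables (size P) K colourList μ
      count≡0 : ∀ z → proj₁ μ count z ≡ 0
      fresh   : Fresh (proj₁ μ)

  run-tables : let μ = start (encodePuzzle K P) in AfterTables (⟦ tables ⟧ μ) × Within G tables tablesCost μ
  run-tables = record
    { tables≡ = proj₁ tables✓
    ; count≡0 = frame tables refl μ
    ; fresh   = record { items≡0 = frame tables refl μ 0 ; slot≡0 = frame tables refl μ 0
                       ; subset≡0 = frame tables refl μ 0 ; ways≡0 = frame tables refl μ } }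
    , proj₂ tables✓
    where
    μ : Mem
    μ = start (encodePuzzle K P)
    tables✓ : Tables (size P) K colourList (⟦ tables ⟧ μ) × Within G tables tablesCost μ
    tables✓ = tables-correct (size P) K colourList 1≤G K<G N≤G

  record AfterReading (μ : Mem) : Set where
    field
      colours≡ : proj₁ μ numColours 0 ≡ K
      pairs≡   : proj₁ μ numPairs 0 ≡ tri (suc K)
      tally    : Tally K (proj₁ μ)
      row      : expand (proj₁ μ count) (tri (tri (suc K))) ⇌ kinds P
      fresh    : Fresh (proj₁ μ)

  reading : Cmd
  reading = for (var numPieces) readPiece

  run-reading : ∀ μ → AfterTables μ →
    AfterReading (⟦ reading ⟧ μ) × Within G reading (expCost (var numPieces) + 4 + (readCost + 3 + 1)) μ
  run-reading μ after with loop-rule readPiece Reads readCost readPiece-correct (proj₁ μ numPieces 0) μ initially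
    where
    open AfterTables after
    open Tables tables≡
    initially : Reads (proj₁ μ numPieces 0) μ
    initially = allFin (size P) , trans (length-tabulate (λ i → i)) (sym pieces≡) , input≡
      , record { triangle≡ = triangle≡ ; count≤4 = λ z → ≤-trans (≤-reflexive (count≡0 z)) z≤n
               ; known = λ z 0<c → ⊥-elim (<⇒≢ 0<c (sym (count≡0 z))) }
      , ↭⇒⇌ (↭-reflexive (cong (_++ kinds P)
               (trans (expand-cong (tri (tri (suc K))) (λ z _ → count≡0 z)) (none (tri (tri (suc K)))))))
      where
      none : ∀ n → expand (λ _ → 0) n ≡ []
      none zero    = refl
      none (suc n) = none n
  ... | ([] , _ , _ , tally , row) , t = record
    { colours≡ = trans (frame reading refl μ 0) colours≡
    ; pairs≡   = trans (frame reading refl μ 0) pairs≡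
    ; tally    = tally
    ; row      = ⇌-trans (↭⇒⇌ (↭-reflexive (sym (++-identityʳ _)))) row
    ; fresh    = record { items≡0 = trans (frame reading refl μ 0) items≡0
                        ; slot≡0 = trans (frame reading refl μ 0) slot≡0
                        ; subset≡0 = trans (frame reading refl μ 0) subset≡0
                        ; ways≡0 = λ i → trans (frame reading refl μ i) (ways≡0 i) } }
    , within-for (var numPieces) readPiece (readCost + 3) μ 1≤G
        (*-bound (readCost + 3) t (≤-trans (≤-reflexive pieces≡) M≤G))
    where
    open AfterTables after
    open Tables tables≡
    open Fresh fresh

  record AfterItems (μ : Mem) : Set where
    field
      zs       : List ℕ
      colours≡ : proj₁ μ numColours 0 ≡ K
      length≤  : length zs ≤ tri (tri (suc K)) * 4
      listed   : Listed (suc K) zs (proj₁ μ)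
      known    : ∀ z → z ∈ zs → Known K (proj₁ μ) z
      row      : zs ⇌ kinds P
      slot≡0   : proj₁ μ slot 0 ≡ 0
      subset≡0 : proj₁ μ subset 0 ≡ 0
      ways≡0   : ∀ i → proj₁ μ ways i ≡ 0

  known-cong : ∀ {z r t l b r′ t′ l′ b′} → r′ ≡ r → t′ ≡ t → l′ ≡ l → b′ ≡ b →
               KnownKind K z r t l b → KnownKind K z r′ t′ l′ b′
  known-cong refl refl refl refl k = k

  run-items : ∀ μ → AfterReading μ → AfterItems (⟦ items ⟧ μ) × Within G items itemsCost μ
  run-items μ after = record
    { zs = expand (proj₁ μ count) (tri (tri (suc K)))
    ; colours≡ = trans (frame items refl μ 0) colours≡
    ; length≤ = expand-length (tri (tri (suc K))) (Tally.count≤4 tally)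
    ; listed = proj₁ items✓
    ; known = λ z z∈ → known-cong (frame items refl μ z) (frame items refl μ z)
                                     (frame items refl μ z) (frame items refl μ z)
                (Tally.known tally z (∈-expand (tri (tri (suc K))) z∈))
    ; row = row
    ; slot≡0 = trans (frame items refl μ 0) slot≡0
    ; subset≡0 = trans (frame items refl μ 0) subset≡0
    ; ways≡0 = λ i → trans (frame items refl μ i) (ways≡0 i) }
    , proj₂ items✓
    where
    open AfterReading after
    open Fresh fresh
    items✓ = items-correct (proj₁ μ) (proj₂ μ) 1≤G n≤G colours≡ pairs≡ items≡0 tally

  record AfterBase (μ : Mem) : Set where
    field
      zs       : List ℕ
      length≤  : length zs ≤ tri (tri (suc K)) * 4
      row      : zs ⇌ kinds P
      setting  : Table.Setting K zs (proj₁ μ)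
      subsets≡ : proj₁ μ numSubsets 0 ≡ 2 ^ length zs
      subset≡0 : proj₁ μ subset 0 ≡ 0
      based    : Base (suc K) (proj₁ μ)

  run-base : ∀ μ → AfterItems μ → AfterBase (⟦ base ⟧ μ) × Within G base initCost μ
  run-base μ after = record
    { zs = zs ; length≤ = length≤ ; row = row
    ; setting = record
        { colours≡ = trans (frame base refl μ 0) colours≡
        ; items≡ = trans (frame base refl μ 0) items≡
        ; stored = stored-cong {σ = proj₁ μ} zs (λ i _ → frame base refl μ i) (λ i _ → frame base refl μ i) stored
        ; known = λ z z∈ → known-cong (frame base refl μ z) (frame base refl μ z) (frame base refl μ z)
                    (frame base refl μ z) (known z z∈) }
    ; subsets≡ = trans (frame base refl μ 0) subsets≡
    ; subset≡0 = trans (frame base refl μ 0) subset≡0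
    ; based = proj₁ base✓ }
    , proj₂ base✓
    where
    open AfterItems after
    open Listed listed
    base✓ = base-correct (proj₁ μ) (proj₂ μ) 1≤G K<G colours≡
              record { slot≡ = slot≡0 ; ones = λ _ () ; zeros = λ i _ → ways≡0 i }

  -- The cost per subset is affine in the number m of items; it is brought into the form m + 1 times
  -- a constant, which is `stepCost`.
  affine-bound : ∀ a b c d x m → a + (b + (c + (d + (m * x + 1)))) + 3 ≤ (m + 1) * (a + (b + (c + d)) + 4 + x)
  affine-bound a b c d x m = ≤-trans (m≤m+n _ (x + m * (a + (b + (c + d)) + 4))) (≤-reflexive (rearrange a b c d x m))
    where
    rearrange : ∀ a b c d x m → a + (b + (c + (d + (m * x + 1)))) + 3 + (x + m * (a + (b + (c + d)) + 4))
                ≡ (m + 1) * (a + (b + (c + d)) + 4 + x)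
    rearrange = solve-∀

  Answered : Mem → Set
  Answered μ = (0 < eval answer (proj₁ μ) → Row (kinds P))
             × (Row (kinds P) → 0 < eval answer (proj₁ μ))

  run-subsets : ∀ next k zs → Search.Advances K zs next k → k + 3 ≤ (length zs + 1) * stepCost →
    length zs ≤ tri (tri (suc K)) * 4 → zs ⇌ kinds P → ∀ μ → proj₁ μ numSubsets 0 ≡ 2 ^ length zs →
    Search.Filling K zs 0 (proj₁ μ) → let c = for (var numSubsets ⊖ con 1) next in
    Answered (⟦ c ⟧ μ) × Within G c searchCost μ
  run-subsets next k zs advances k≤ length≤ row μ subsets≡ filling
    with Search.filling-loop K zs next advances (proj₁ μ numSubsets 0 ∸ 1) μ
           (pred-power< {m = length zs} subsets≡) filling
  ... | filling′ , t =
    ( (λ 0<v → proj₁ row (subst Row full≡ (sound n 0 n< z≤n (subst (λ a → 0 < σ ways a) cell≡ 0<v))))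
    , (λ r → subst (λ a → 0 < σ ways a) (sym cell≡) (done n 0 ≤-refl z≤n (subst Row (sym full≡) (proj₂ row r)))))
    , within-for (var numSubsets ⊖ con 1) next stepCost μ 1≤G (≤-trans t (≤-trans (*-mono-≤ n≤ k≤)
        (≤-trans (≤-reflexive (sym (*-assoc (2 ^ length zs) (length zs + 1) stepCost)))
        (≤-trans (*-monoˡ-≤ stepCost (2^m≤G length≤)) (≤-reflexive (*-comm G stepCost))))))
    where
    open Search.Filling filling′
    n : ℕ
    n = proj₁ μ numSubsets 0 ∸ 1
    σ : Store
    σ = proj₁ (iter n ⟦ next ⟧ μ)
    n≤ : n ≤ 2 ^ length zs
    n≤ = ≤-trans (m∸n≤m _ 1) (≤-reflexive subsets≡)
    n< : n < 2 ^ length zs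
    n< = pred-power< {m = length zs} subsets≡
    cell≡ : σ subset 0 ≡ n * suc K + 0
    cell≡ = trans subset≡ (sym (+-identityʳ (n * suc K)))
    -- The last row has number 2 ^ m minus 1, all of whose m digits are 1.
    full≡ : sel zs n ≡ zs
    full≡ = trans (cong (λ k → sel zs (k ∸ 1)) subsets≡) (sel-full zs)

  record Spec (c : Cmd) (a : ℕ) (S Q : Mem → Set) : Set where
    constructor spec
    field
      holds : ∀ μ → S μ → Q (⟦ c ⟧ μ) × Within G c a μ

  spec-▸ : ∀ {c c′ a b S R Q} → Spec c a S R → Spec c′ b R Q → Spec (c ▸ c′) (a + b) S Q
  spec-▸ {c} {c′} {a} {b} {S} {R} {Q} (spec f) (spec g) = spec λ μ s → continue μ (f μ s)
    where
    continue : ∀ μ → R (⟦ c ⟧ μ) × Within G c a μ → Q (⟦ c ▸ c′ ⟧ μ) × Within G (c ▸ c′) (a + b) μ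
    continue μ (r , t) with g (⟦ c ⟧ μ) r
    ... | q , u = q , within-▸ {c = c} {c′} t u

  run-search : ∀ μ → AfterBase μ → Answered (⟦ search ⟧ μ) × Within G search searchCost μ
  run-search μ after = run-subsets (nextWith (tryWith useItem)) (nextCost (tryCost useCost)) zs
    (nextWith-correct (tryWith useItem) (tryWith-correct useItem useCost (λ _ → ≤-refl) useItem-correct))
    (affine-bound (cost (subset ≔ var subset ⊕ (var numColours ⊕ con 1)) (start []))
      (cost (rest ≔ var subset) (start [])) (cost (item ≔ var numItems) (start [])) (expCost (var numItems) + 4)
      (tryCost useCost + 3) (length zs))
    length≤ row μ subsets≡
    record
      { setting = setting
      ; subset≡ = subset≡0
      ; sound = sound₀
      ; done = λ { zero c _ c≤ _ → subst (0 <_) (sym (Base.ones based c (s≤s c≤))) (s≤s z≤n)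
                 ; (suc _) _ (s≤s ()) _ _ } }
    where
    open AfterBase after
    open Search K zs
    open Table K zs using (Sound; Cell)
    sound₀ : Sound (proj₁ μ ways)
    -- Rows from 1 on begin at offset K + 1, behind the ones written by `base`.
    sound₀ (suc s) c _ _ 0<w =
      ⊥-elim (<⇒≢ 0<w (sym (Base.zeros based (suc s * suc K + c) (≤-trans (m≤m+n (suc K) (s * suc K)) (m≤m+n _ c)))))
    sound₀ zero zero    _ _ _ = 0 , [] , 0 , [] , ↭-reflexive (sym (sel-zero zs))
    sound₀ zero (suc c) _ _ _ = [] , suc c , [] , ↭-reflexive (sym (sel-zero zs))

  run-matcher : Spec matcher matcherCost (_≡ start (encodePuzzle K P)) Answered
  run-matcher = spec-▸ (spec λ { _ refl → run-tables })
    (spec-▸ (spec run-reading) (spec-▸ (spec run-items) (spec-▸ (spec run-base) (spec run-search))))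

-- The running time in terms of the number of colours

double-tri : ∀ n → tri n + tri n ≡ n * (n + 1)
double-tri zero    = refl
double-tri (suc n) = trans (collect n (tri n)) (trans (cong (2 * suc n +_) (double-tri n)) (expandʳ n))
  where
  collect : ∀ n t → suc n + t + (suc n + t) ≡ 2 * suc n + (t + t)
  collect = solve-∀
  expandʳ : ∀ n → 2 * suc n + n * (n + 1) ≡ suc n * (suc n + 1)
  expandʳ = solve-∀

-- With q = (K + 1)(K + 2), twice the number of colour pair codes, 2L is q² + 2q, one less than (q +
-- 1)². From K = 10 on this is below 2K⁴; the constant 12321 = 111² is the value of (q + 1)² at K =
-- 9.
exponent-bound : ∀ K → let L = tri (tri (suc K)) * 4 in L + L ≤ 2 * K ^ 4 + 12321
exponent-bound K = ≤-trans (≤-reflexive exact) (≤-trans (m≤m+n (q * q + 2 * q) 1)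
  (≤-trans (≤-reflexive (square q)) (bound (K ≤? 9))))
  where
  N q : ℕ
  N = tri (suc K)
  q = suc K * (suc K + 1)
  exact : tri N * 4 + tri N * 4 ≡ q * q + 2 * q
  exact = trans (gather (tri N)) (trans (cong (4 *_) (double-tri N))
    (trans (distribute N) (cong (λ q → q * q + 2 * q) (double-tri (suc K)))))
    where
    gather : ∀ t → t * 4 + t * 4 ≡ 4 * (t + t)
    gather = solve-∀
    distribute : ∀ n → 4 * (n * (n + 1)) ≡ (n + n) * (n + n) + 2 * (n + n)
    distribute = solve-∀
  square : ∀ q → q * q + 2 * q + 1 ≡ (q + 1) * (q + 1)
  square = solve-∀
  bound : Dec (K ≤ 9) → (q + 1) * (q + 1) ≤ 2 * K ^ 4 + 12321
  bound (yes K≤9) = ≤-trans (*-mono-≤ h≤111 h≤111) (m≤n+m 12321 (2 * K ^ 4))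
    where
    h≤111 : q + 1 ≤ 111
    h≤111 = +-monoˡ-≤ 1 (*-mono-≤ (s≤s K≤9) (+-monoˡ-≤ 1 (s≤s K≤9)))
  bound (no K≰9) with m≤n⇒∃[o]m+o≡n (≰⇒> K≰9)
  -- With K = 10 + j, the difference of the two sides is a polynomial in j with nonnegative
  -- coefficients.
  ... | j , refl = ≤-trans (m≤m+n _ (j * (j * (j * j)) + 34 * (j * (j * j)) + 405 * (j * j) + 1882 * j + 2311))
    (≤-trans (≤-reflexive (difference j)) (m≤m+n _ 12321))
    where
    difference : ∀ j → ((11 + j) * (11 + j + 1) + 1) * ((11 + j) * (11 + j + 1) + 1)
                       + (j * (j * (j * j)) + 34 * (j * (j * j)) + 405 * (j * j) + 1882 * j + 2311)
                     ≡ 2 * ((10 + j) * ((10 + j) * ((10 + j) * ((10 + j) * 1))))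
    difference = solve-∀

abstract
  power-bound : ∃[ C ] ∀ K → let L = tri (tri (suc K)) * 4 in 2 ^ L * 2 ^ L ≤ C * 5 ^ (K ^ 4)
  power-bound = 2 ^ 12321 , λ K → let L = tri (tri (suc K)) * 4 in begin
    2 ^ L * 2 ^ L                 ≡⟨ sym (^-distribˡ-+-* 2 L L) ⟩
    2 ^ (L + L)                   ≤⟨ ^-monoʳ-≤ 2 (exponent-bound K) ⟩
    2 ^ (2 * K ^ 4 + 12321)       ≡⟨ ^-distribˡ-+-* 2 (2 * K ^ 4) 12321 ⟩
    2 ^ (2 * K ^ 4) * 2 ^ 12321   ≡⟨ cong (_* 2 ^ 12321) (sym (^-*-assoc 2 2 (K ^ 4))) ⟩
    4 ^ (K ^ 4) * 2 ^ 12321       ≤⟨ *-monoˡ-≤ (2 ^ 12321) (^-monoˡ-≤ (K ^ 4) (n≤1+n 4)) ⟩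
    5 ^ (K ^ 4) * 2 ^ 12321       ≡⟨ *-comm (5 ^ (K ^ 4)) (2 ^ 12321) ⟩
    2 ^ 12321 * 5 ^ (K ^ 4)       ∎
    where open ≤-Reasoning

n<2^n : ∀ n → n < 2 ^ n
n<2^n zero    = s≤s z≤n
n<2^n (suc n) = ≤-trans (+-mono-≤ (m^n>0 2 n) (n<2^n n)) (≤-reflexive (cong (2 ^ n +_) (sym (+-identityʳ (2 ^ n)))))

n≤tri : ∀ n → n ≤ tri n
n≤tri zero    = z≤n
n≤tri (suc n) = m≤m+n (suc n) (tri n)

reflects-positive : ∀ {A : Set} v → (0 < v → A) → (A → 0 < v) → Reflects A (0 <ᵇ v)
reflects-positive zero    f g = ofⁿ (λ a → n≮0 (g a))
reflects-positive (suc v) f g = ofʸ (f (s≤s z≤n))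

program-decides : ∀ c e xs {A : Set} {k G} → 1 ≤ G → let v = eval e (proj₁ (⟦ c ⟧ (start xs))) in
  (0 < v → A) × (A → 0 < v) → cost c (start xs) ≤ k * G →
  ∃[ t ] ∃[ b ] run (program c e) t (initial xs) ≡ just b × Reflects A b × t ≤ (k + (expCost e + 2)) * G
program-decides c e xs {k = k} {G} 1≤G (f , g) t≤ =
  cost c (start xs) + (expCost e + 2) , (0 <ᵇ v) , program-correct c e xs , reflects-positive v f g
  , ≤-trans (+-mono-≤ t≤ (m≤m*n (expCost e + 2) G)) (≤-reflexive (sym (*-distribʳ-+ G k (expCost e + 2))))
  where
  v : ℕ
  v = eval e (proj₁ (⟦ c ⟧ (start xs)))
  instance _ = >-nonZero 1≤G

Decides : ∀ {K} → Puzzle K → ℕ → Set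
Decides {K} P τ = ∃[ t ] ∃[ b ] run (program matcher answer) t (initial (encodePuzzle K P)) ≡ just b
                              × Reflects (Solvable P) b × t ≤ τ

matcher-decides : ∀ {K} (P : Puzzle K) {G} → 1 ≤ G → size P ≤ G →
  (let L = tri (tri (suc K)) * 4 in 2 ^ L * 2 ^ L ≤ G) →
  Decides P ((matcherCost + (expCost answer + 2)) * G)
matcher-decides {K} P {G} 1≤G M≤G 2^L≤G = conclude (Run.Spec.holds run-matcher (start (encodePuzzle K P)) refl)
  where
  L : ℕ
  L = tri (tri (suc K)) * 4
  n≤L : tri (tri (suc K)) ≤ L
  n≤L = m≤m*n (tri (tri (suc K))) 4
  L≤G : L ≤ G
  L≤G = ≤-trans (<⇒≤ (n<2^n L)) (≤-trans (m≤m*n (2 ^ L) (2 ^ L)) 2^L≤G)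
    where instance _ = >-nonZero (m^n>0 2 L)
  n≤G : tri (tri (suc K)) ≤ G
  n≤G = ≤-trans n≤L L≤G
  N≤G : tri (suc K) ≤ G
  N≤G = ≤-trans (n≤tri (tri (suc K))) n≤G
  K<G : suc K ≤ G
  K<G = ≤-trans (n≤tri (suc K)) N≤G
  2^m≤G : ∀ {m} → m ≤ L → 2 ^ m * (m + 1) ≤ G
  -- One factor 2 ^ L pays for the subsets, the other for m + 1 ≤ 2 ^ m.
  2^m≤G {m} m≤L = ≤-trans (*-mono-≤ (^-monoʳ-≤ 2 m≤L)
    (≤-trans (≤-trans (≤-reflexive (+-comm m 1)) (n<2^n m)) (^-monoʳ-≤ 2 m≤L))) 2^L≤G
  open Run P 1≤G M≤G K<G N≤G n≤G 2^m≤G using (Answered; run-matcher)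
  conclude : Answered (⟦ matcher ⟧ (start (encodePuzzle K P))) ×
             Within G matcher matcherCost (start (encodePuzzle K P)) →
    Decides P ((matcherCost + (expCost answer + 2)) * G)
  conclude ((f , g) , within t≤) = program-decides matcher answer (encodePuzzle K P)
    {Solvable P} {matcherCost} {G} 1≤G
    ((λ 0<v → row⇒solvable P (f 0<v)) , (λ s → g (solvable⇒row P s))) t≤

rowMatchingAnyK-time : SolvableInTimeO rowMatchingAnyK (λ (K , P) → size P + 5 ^ (K ^ 4))
rowMatchingAnyK-time = program matcher answer , a * suc C , decide
  where
  a C : ℕ
  a = matcherCost + (expCost answer + 2)
  C = proj₁ power-bound
  decide : ∀ ((K , P) : ∃ Puzzle) → ∃[ t ] ∃[ b ]
    run (program matcher answer) t (initial (encodePuzzle K P)) ≡ just b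
    × Reflects (Solvable P) b × (0 < size P + 5 ^ (K ^ 4) → t ≤ a * suc C * (size P + 5 ^ (K ^ 4)))
  decide (K , P) = relax (matcher-decides P 1≤G M≤G 2^L≤G)
    where
    F G : ℕ
    F = size P + 5 ^ (K ^ 4)
    G = suc C * F
    F≤G : F ≤ G
    F≤G = m≤m+n F (C * F)
    1≤G : 1 ≤ G
    1≤G = ≤-trans (m^n>0 5 (K ^ 4)) (≤-trans (m≤n+m _ (size P)) F≤G)
    M≤G : size P ≤ G
    M≤G = ≤-trans (m≤m+n (size P) _) F≤G
    2^L≤G : let L = tri (tri (suc K)) * 4 in 2 ^ L * 2 ^ L ≤ G
    2^L≤G = ≤-trans (proj₂ power-bound K) (*-mono-≤ (n≤1+n C) (m≤n+m (5 ^ (K ^ 4)) (size P)))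
    relax : Decides P (a * G) → ∃[ t ] ∃[ b ] run (program matcher answer) t (initial (encodePuzzle K P)) ≡ just b
      × Reflects (Solvable P) b × (0 < F → t ≤ a * suc C * F)
    relax (t , b , runs , reflects , t≤) =
      t , b , runs , reflects , λ _ → ≤-trans t≤ (≤-reflexive (sym (*-assoc a (suc C) F)))

fixed-colours : SolvableInTimeO rowMatchingAnyK (λ (K , P) → size P + 5 ^ (K ^ 4)) →
                ∀ K → SolvableInTimeO (rowMatching K) size
fixed-colours (p , c , solves) K = p , c * (1 + 5 ^ (K ^ 4)) , λ P →
  let t , b , runs , reflects , t≤ = solves (K , P) in
  t , b , runs , reflects , λ 0<M → ≤-trans (t≤ (≤-trans 0<M (m≤m+n (size P) _)))
    (≤-trans (*-monoʳ-≤ c (absorb 0<M)) (≤-reflexive (sym (*-assoc c (1 + 5 ^ (K ^ 4)) (size P)))))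
  where
  -- An additive constant is at most a multiple of M only because M is positive.
  absorb : ∀ {M} → 0 < M → M + 5 ^ (K ^ 4) ≤ (1 + 5 ^ (K ^ 4)) * M
  absorb {M} 0<M = +-monoʳ-≤ M (m≤m*n (5 ^ (K ^ 4)) M)
    where instance _ = >-nonZero 0<M

theorem4p1 : SolvableInTimeO (rowMatching 2) size
    × SolvableInTimeO rowMatchingAnyK (λ (K , P) → size P + 5 ^ (K ^ 4))
theorem4p1 = fixed-colours rowMatchingAnyK-time 2 , rowMatchingAnyK-time
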